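{- Let $n>1$ be an odd integer. Then, modulo $[n]_{q^2}^4\Phi_n(q^2)$, $$\sum_{k=0}^{(n+1)/2}[4k-1]_{q^2}[4k-1]^2\frac{(q^{ -2};q^4)_k^4}{(q^4;q^4)_k^4}q^{4k} \equiv (2q+2q^{ -1}-1)[n]_{q^2}^4,$$ and, modulo $[n]_{q^2}^4\Phi_n(q^2)$, $$\sum_{k=0}^{n-1}[4k-1]_{q^2}[4k-1]^2\frac{(q^{ -2};q^4)_k^4}{(q^4;q^4)_k^4}q^{4k} \equiv (2q+2q^{ -1}-1)[n]_{q^2}^4.$$
   Context: For an integer $m$ (possibly negative), $[m]=[m]_q=(1-q^m)/(1-q)$ is the $q$-integer, and $[m]_{q^2}=(1-q^{2m})/(1-q^2)$. The $q$-shifted factorial is $(a;q)_0=1$ and $(a;q)_k=(1-a)(1-aq)\cdots(1-aq^{k-1})$ for $k\ge1$. $\Phi_n(q)$ denotes the $n$-th cyclotomic polynomial in $q$. A congruence $A(q)\equiv B(q)$ modulo a polynomial $P(q)$ between rational functions means that $A(q)-B(q)$, written as a reduced fraction, has numerator divisible by $P(q)$ and denominator coprime to $P(q)$ (in $\mathbb{Z}[q]$, allowing powers of $q$ in denominators). -}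

module Defs where

open import Data.Integer as ℤ using (ℤ; +_; -[1+_]; 0ℤ; 1ℤ)
open import Data.Nat as ℕ using (ℕ; zero; suc; _∸_)
open import Data.Nat.Divisibility using (_∣?_)
open import Data.List using (List; []; _∷_; _++_; [_]; map; replicate; reverse; length; foldr)
open import Data.Product using (Σ; ∃; _×_; _,_)
open import Relation.Nullary using (¬_; yes; no)
open import Relation.Binary.PropositionalEquality using (_≡_; _≢_; refl)

-- Polynomials in ℤ[q], as coefficient lists (lowest degree first).

Poly : Set
Poly = List ℤ

infixl 6 _+P_ _-P_
infixl 7 _*P_

_+P_ : Poly → Poly → Poly
[]      +P q       = q
(a ∷ p) +P []      = a ∷ p
(a ∷ p) +P (b ∷ q) = (a ℤ.+ b) ∷ (p +P q)

negP : Poly → Poly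
negP = map (λ a → ℤ.- a)

_-P_ : Poly → Poly → Poly
p -P q = p +P negP q

scaleP : ℤ → Poly → Poly
scaleP c = map (c ℤ.*_)

_*P_ : Poly → Poly → Poly
[]      *P q = []
(a ∷ p) *P q = scaleP a q +P (0ℤ ∷ (p *P q))

oneP : Poly
oneP = [ 1ℤ ]

X^ : ℕ → Poly
X^ n = replicate n 0ℤ ++ [ 1ℤ ]

powP : Poly → ℕ → Poly
powP p zero    = oneP
powP p (suc k) = powP p k *P p

strip : Poly → Poly
strip [] = []
strip (a ∷ p) with strip p
... | b ∷ r = a ∷ b ∷ r
... | [] with a ℤ.≟ 0ℤ
...   | yes _ = []
...   | no  _ = [ a ]

infix 4 _≈P_
_≈P_ : Poly → Poly → Set
p ≈P q = strip (p -P q) ≡ []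

NonZeroP : Poly → Set
NonZeroP p = ¬ (p ≈P [])

composeX^ : Poly → ℕ → Poly
composeX^ p e = foldr (λ a acc → [ a ] +P (X^ e *P acc)) [] p

private
  subFront : List ℤ → List ℤ → List ℤ
  subFront r        []       = r
  subFront []       (c ∷ cs) = ℤ.- c ∷ subFront [] cs
  subFront (a ∷ r)  (c ∷ cs) = (a ℤ.- c) ∷ subFront r cs

  -- high-degree-first lists; gt = divisor without its leading coefficient 1
  divH : ℕ → List ℤ → List ℤ → List ℤ
  divH zero    f        gt = []
  divH (suc k) []       gt = []
  divH (suc k) (c ∷ rest) gt with length gt ℕ.≤? length rest
  ... | no  _ = []
  ... | yes _ = c ∷ divH k (subFront rest (map (c ℤ.*_) gt)) gt

  tailL : List ℤ → List ℤ
  tailL []      = []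
  tailL (_ ∷ r) = r

divMonic : Poly → Poly → Poly
divMonic f g = let fh = reverse (strip f) in
  reverse (divH (length fh) fh (tailL (reverse (strip g))))

-- Cyclotomic polynomials, via  x^N - 1 = ∏_{d ∣ N} Φ_d(x).

private
  -- product of the Φ_d (d ≥ start, listed in ps) with d ∣ N
  prodDivisors : ℕ → ℕ → List Poly → Poly
  prodDivisors N d []       = oneP
  prodDivisors N d (p ∷ ps) with d ∣? N
  ... | yes _ = p *P prodDivisors N (suc d) ps
  ... | no  _ = prodDivisors N (suc d) ps

  cycList : ℕ → List Poly
  cycList zero    = []
  cycList (suc n) = let ps = cycList n in
    ps ++ [ divMonic (X^ (suc n) -P oneP) (prodDivisors (suc n) 1 ps) ]

  lastP : List Poly → Poly
  lastP []           = oneP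
  lastP (p ∷ [])     = p
  lastP (p ∷ q ∷ ps) = lastP (q ∷ ps)

-- Φ_n(q) for n ≥ 1 (Φ_0 is set to 1, never used)
cyclotomic : ℕ → Poly
cyclotomic n = lastP (cycList n)

private
  _ : strip (cyclotomic 1) ≡ -[1+ 0 ] ∷ 1ℤ ∷ []
  _ = refl
  _ : strip (cyclotomic 6) ≡ 1ℤ ∷ -[1+ 0 ] ∷ 1ℤ ∷ []
  _ = refl
  _ : strip (cyclotomic 9) ≡ 1ℤ ∷ 0ℤ ∷ 0ℤ ∷ 1ℤ ∷ 0ℤ ∷ 0ℤ ∷ 1ℤ ∷ []
  _ = refl
  _ : strip (cyclotomic 12) ≡ 1ℤ ∷ 0ℤ ∷ -[1+ 0 ] ∷ 0ℤ ∷ 1ℤ ∷ []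
  _ = refl

record Frac : Set where
  constructor _//_
  field
    num : Poly
    den : Poly
open Frac public

infixl 6 _+F_ _-F_
infixl 7 _*F_ _÷F_

_+F_ : Frac → Frac → Frac
a +F b = (num a *P den b +P num b *P den a) // (den a *P den b)

_-F_ : Frac → Frac → Frac
a -F b = (num a *P den b -P num b *P den a) // (den a *P den b)

_*F_ : Frac → Frac → Frac
a *F b = (num a *P num b) // (den a *P den b)

_÷F_ : Frac → Frac → Frac
a ÷F b = (num a *P den b) // (den a *P num b)

zeroF oneF : Frac
zeroF = [] // oneP
oneF  = oneP // oneP

constF : ℤ → Frac
constF c = [ c ] // oneP

powF : Frac → ℕ → Frac
powF x zero    = oneF
powF x (suc k) = powF x k *F x

qpow : ℤ → Frac
qpow (+ n)      = X^ n // oneP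
qpow -[1+ n ]   = oneP // X^ (suc n)

qint : ℕ → ℤ → Frac
qint e m = (oneF -F qpow (+ e ℤ.* m)) ÷F (oneF -F qpow (+ e))

poch : Frac → Frac → ℕ → Frac
poch a b zero    = oneF
poch a b (suc k) = poch a b k *F (oneF -F a *F powF b k)

sumF : (ℕ → Frac) → ℕ → Frac
sumF f zero    = zeroF
sumF f (suc N) = sumF f N +F f N

qintPoly : ℕ → ℕ → Poly
qintPoly e zero    = []
qintPoly e (suc n) = qintPoly e n +P X^ (e ℕ.* n)

-- Congruences of rational functions modulo a polynomial P.
-- A ≡ B (mod P)  iff  A - B = P·C/D with C, D ∈ ℤ[q] and D coprime to P.
-- Coprimality of D and P (no common non-constant factor) is expressed by a
-- Bezout identity s D + t P = m with m a nonzero integer.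

CoprimeP : Poly → Poly → Set
CoprimeP D P = Σ Poly λ s → Σ Poly λ t → Σ ℤ λ m →
  (m ≢ 0ℤ) × (s *P D +P t *P P ≈P [ m ])

infix 4 _≡F_[mod_]
_≡F_[mod_] : Frac → Frac → Poly → Set
A ≡F B [mod P ] =
  NonZeroP (den A) × NonZeroP (den B) ×
  (Σ Poly λ C → Σ Poly λ D → CoprimeP D P ×
     (num (A -F B) *P D ≈P P *P C *P den (A -F B)))

term : ℕ → Frac
term k =
  qint 2 m *F powF (qint 1 m) 2
    *F (powF (poch (qpow -[1+ 1 ]) (qpow (+ 4)) k) 4
         ÷F powF (poch (qpow (+ 4)) (qpow (+ 4)) k) 4)
    *F qpow (+ (4 ℕ.* k))
  where
  m : ℤ
  m = + (4 ℕ.* k) ℤ.- 1ℤ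

rhs : ℕ → Frac
rhs n = (constF (+ 2) *F qpow (+ 1) +F constF (+ 2) *F qpow -[1+ 0 ] -F oneF)
        *F powF (qint 2 (+ n)) 4

modulus : ℕ → Poly
modulus n = powP (qintPoly 2 n) 4 *P composeX^ (cyclotomic n) 2

{-# OPTIONS --safe #-}
-- Write Q = q². The sum telescopes:
--   Σ_{k≤N} = q⁻⁴ (2q [2N]_Q [2N+1]_Q − Q^{2N}) ((Q;Q²)_N / (Q²;Q²)_N)⁴,
-- and (Q;Q²)_N / (Q²;Q²)_N = [2N choose N]_Q / (−Q;Q)_N². For N = n−1 and N = (n+1)/2 the
-- q-binomial coefficient is [n]_Q times a polynomial C (a q-Catalan number in the first case),
-- and (−Q;Q)_N is prime to Qⁿ − 1 because n is odd. It remains to compute C modulo Φₙ(Q):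
-- reducing exponents modulo n pairs the factors of (Q;Q²)_N other than 1 − Qⁿ with those of
-- (Q²;Q²)_N, and gives C ≡ −Q (−Q;Q)_N² and C ≡ ±Q^{h²} (−Q;Q)_N², n = 2h+1, respectively.
module Submission where

open import Defs
open import Algebra.Bundles using (CommutativeRing)
import Algebra.Solver.Ring
open import Algebra.Solver.Ring.AlmostCommutativeRing using (fromCommutativeRing; _-Raw-AlmostCommutative⟶_)
open import Data.Integer as ℤ using (ℤ; +_; -[1+_]; 0ℤ; 1ℤ)
import Data.Integer.Properties as ℤₚ
open import Data.List using (List; []; _∷_; _++_; [_]; map; reverse; length; foldr)
import Data.List.Properties as Listₚ
open import Data.Maybe using (Maybe; just; nothing)
open import Data.Nat as ℕ using (ℕ; zero; suc; _+_; _∸_; _≤_; _<_; s≤s; z≤n)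
open import Data.Nat.Divisibility as ℕ∣ using (_∣_; _∣?_; divides)
open import Data.Nat.DivMod using (_/_; _%_; m≡m%n+[m/n]*n; m*n/n≡m)
open import Data.Nat.GCD using (GCD; module Bézout)
import Data.Nat.Properties as ℕₚ
import Data.Nat.Tactic.RingSolver as ℕRing
open import Data.Product using (∃; ∃₂; _×_; _,_; proj₁; proj₂)
open import Data.Sum as Sum using (_⊎_; inj₁; inj₂)
open import Relation.Binary.Bundles using (Setoid)
open import Relation.Binary.Definitions using (tri<; tri≈; tri>)
open import Relation.Binary.PropositionalEquality using (_≡_; _≢_; refl; sym; trans; cong; cong₂; subst)
import Relation.Binary.Reasoning.Setoid as SetoidReasoning
open import Relation.Nullary using (¬_; yes; no; contradiction)

-- The polynomial ring

-- Both sides carry [n]_Q⁴ as an exact factor, and the other factor of their difference has a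
-- denominator prime to Qⁿ - 1, so only its numerator has to be reduced, and only modulo Φₙ(Q).
-- There Q is a primitive n-th root of unity, and 2N is 1 modulo n for N = (n+1)/2 and -2 for N =
-- n-1. In the first case the bracket of the telescoped sum becomes 2q(1+Q) - Q, and C⁴ brings
-- Q^{4h²} ≡ Q; in the second it becomes 2q(1+Q)Q⁻³ - Q⁻², and C⁴ brings Q⁴. Both products are q⁴(2q
-- + 2q⁻¹ - 1), up to the same power of (-Q;Q)_N: hence the constant, and hence its agreement in the
-- two sums. The obstacle is that `cyclotomic` is whatever an unchecked long division returns.
-- Exactness of these divisions, that is xⁿ - 1 = ∏ Φ_d, is proved by strong induction together with
-- monicity and with the coprimality of xʲ - 1 and Φₙ. As coprimality means a Bézout identity with a
-- nonzero integer constant, divisibility is treated over ℚ, and division by monic polynomials leads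
-- back to ℤ[q].

coeff : Poly → ℕ → ℤ
coeff []      i       = 0ℤ
coeff (a ∷ p) zero    = a
coeff (a ∷ p) (suc i) = coeff p i

infix 4 _≋_
-- Like `_≈P_` this ignores trailing zeros, but it is proved pointwise, without evaluating `strip`.
-- Being a record and not a function type, it lets `p` and `q` be inferred.
record _≋_ (p q : Poly) : Set where
  constructor coeffwise
  field at : ∀ i → coeff p i ≡ coeff q i
open _≋_

≋-refl : ∀ {p} → p ≋ p
≋-refl = coeffwise λ i → refl

≋-sym : ∀ {p q} → p ≋ q → q ≋ p
≋-sym e = coeffwise λ i → sym (at e i)

≋-trans : ∀ {p q r} → p ≋ q → q ≋ r → p ≋ r
≋-trans e f = coeffwise λ i → trans (at e i) (at f i)

≋-tail : ∀ {a b p q} → (a ∷ p) ≋ (b ∷ q) → p ≋ q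
≋-tail e = coeffwise λ i → at e (suc i)

≋-tail-[] : ∀ {a p} → (a ∷ p) ≋ [] → p ≋ []
≋-tail-[] e = coeffwise λ i → at e (suc i)

∷-cong : ∀ {a b p q} → a ≡ b → p ≋ q → (a ∷ p) ≋ (b ∷ q)
∷-cong a≡b e = coeffwise λ { zero → a≡b ; (suc i) → at e i }

∷-≋-[] : ∀ {a p} → a ≡ 0ℤ → p ≋ [] → (a ∷ p) ≋ []
∷-≋-[] a≡0 e = coeffwise λ { zero → a≡0 ; (suc i) → at e i }

coeff-+P : ∀ p q i → coeff (p +P q) i ≡ coeff p i ℤ.+ coeff q i
coeff-+P []      q       i       = sym (ℤₚ.+-identityˡ _)
coeff-+P (a ∷ p) []      i       = sym (ℤₚ.+-identityʳ _)
coeff-+P (a ∷ p) (b ∷ q) zero    = refl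
coeff-+P (a ∷ p) (b ∷ q) (suc i) = coeff-+P p q i

coeff-map : ∀ (f : ℤ → ℤ) → f 0ℤ ≡ 0ℤ → ∀ p i → coeff (map f p) i ≡ f (coeff p i)
coeff-map f f0 []      i       = sym f0
coeff-map f f0 (a ∷ p) zero    = refl
coeff-map f f0 (a ∷ p) (suc i) = coeff-map f f0 p i

coeff-negP : ∀ p i → coeff (negP p) i ≡ ℤ.- coeff p i
coeff-negP = coeff-map ℤ.-_ refl

coeff-scaleP : ∀ c p i → coeff (scaleP c p) i ≡ c ℤ.* coeff p i
coeff-scaleP c = coeff-map (c ℤ.*_) (ℤₚ.*-zeroʳ c)

+P-cong : ∀ {p p′ q q′} → p ≋ p′ → q ≋ q′ → (p +P q) ≋ (p′ +P q′)
+P-cong {p} {p′} {q} {q′} e f = coeffwise λ i →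
  trans (coeff-+P p q i) (trans (cong₂ ℤ._+_ (at e i) (at f i)) (sym (coeff-+P p′ q′ i)))

negP-cong : ∀ {p q} → p ≋ q → negP p ≋ negP q
negP-cong {p} {q} e = coeffwise λ i →
  trans (coeff-negP p i) (trans (cong ℤ.-_ (at e i)) (sym (coeff-negP q i)))

scaleP-cong : ∀ {c d p q} → c ≡ d → p ≋ q → scaleP c p ≋ scaleP d q
scaleP-cong {c} {d} {p} {q} c≡d e = coeffwise λ i →
  trans (coeff-scaleP c p i) (trans (cong₂ ℤ._*_ c≡d (at e i)) (sym (coeff-scaleP d q i)))

+P-assoc : ∀ p q r → ((p +P q) +P r) ≋ (p +P (q +P r))
+P-assoc p q r = coeffwise λ i → trans (coeff-+P (p +P q) r i)
  (trans (cong (ℤ._+ coeff r i) (coeff-+P p q i))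
  (trans (ℤₚ.+-assoc (coeff p i) (coeff q i) (coeff r i))
  (trans (cong (λ z → coeff p i ℤ.+ z) (sym (coeff-+P q r i))) (sym (coeff-+P p (q +P r) i)))))

+P-comm : ∀ p q → (p +P q) ≋ (q +P p)
+P-comm p q = coeffwise λ i →
  trans (coeff-+P p q i) (trans (ℤₚ.+-comm (coeff p i) (coeff q i)) (sym (coeff-+P q p i)))

+P-identityʳ : ∀ p → (p +P []) ≋ p
+P-identityʳ p = +P-comm p []

+P-inverseˡ : ∀ p → (negP p +P p) ≋ []
+P-inverseˡ p = coeffwise λ i → trans (coeff-+P (negP p) p i)
  (trans (cong (ℤ._+ coeff p i) (coeff-negP p i)) (ℤₚ.+-inverseˡ (coeff p i)))

+P-inverseʳ : ∀ p → (p +P negP p) ≋ []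
+P-inverseʳ p = ≋-trans (+P-comm p (negP p)) (+P-inverseˡ p)

+P-interchange : ∀ p q r s → ((p +P q) +P (r +P s)) ≋ ((p +P r) +P (q +P s))
+P-interchange p q r s =
  ≋-trans (+P-assoc p q (r +P s)) (≋-trans (+P-cong (≋-refl {p}) inner) (≋-sym (+P-assoc p r (q +P s))))
  where
  inner : (q +P (r +P s)) ≋ (r +P (q +P s))
  inner = ≋-trans (≋-sym (+P-assoc q r s)) (≋-trans (+P-cong (+P-comm q r) ≋-refl) (+P-assoc r q s))

scaleP-+P : ∀ c p q → scaleP c (p +P q) ≋ (scaleP c p +P scaleP c q)
scaleP-+P c p q = coeffwise λ i → trans (coeff-scaleP c (p +P q) i)
  (trans (cong (c ℤ.*_) (coeff-+P p q i)) (trans (ℤₚ.*-distribˡ-+ c (coeff p i) (coeff q i))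
  (trans (sym (cong₂ ℤ._+_ (coeff-scaleP c p i) (coeff-scaleP c q i)))
  (sym (coeff-+P (scaleP c p) (scaleP c q) i)))))

scaleP-distrib-+ : ∀ c d p → scaleP (c ℤ.+ d) p ≋ (scaleP c p +P scaleP d p)
scaleP-distrib-+ c d p = coeffwise λ i → trans (coeff-scaleP (c ℤ.+ d) p i)
  (trans (ℤₚ.*-distribʳ-+ (coeff p i) c d)
  (trans (sym (cong₂ ℤ._+_ (coeff-scaleP c p i) (coeff-scaleP d p i)))
  (sym (coeff-+P (scaleP c p) (scaleP d p) i))))

scaleP-scaleP : ∀ c d p → scaleP (c ℤ.* d) p ≋ scaleP c (scaleP d p)
scaleP-scaleP c d p = coeffwise λ i → trans (coeff-scaleP (c ℤ.* d) p i)
  (trans (ℤₚ.*-assoc c d (coeff p i)) (trans (cong (c ℤ.*_) (sym (coeff-scaleP d p i)))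
  (sym (coeff-scaleP c (scaleP d p) i))))

scaleP-0 : ∀ p → scaleP 0ℤ p ≋ []
scaleP-0 p = coeffwise λ i → coeff-scaleP 0ℤ p i

scaleP-1 : ∀ p → scaleP 1ℤ p ≋ p
scaleP-1 p = coeffwise λ i → trans (coeff-scaleP 1ℤ p i) (ℤₚ.*-identityˡ (coeff p i))

*P-zeroˡ : ∀ {p} → p ≋ [] → ∀ q → (p *P q) ≋ []
*P-zeroˡ {[]}    e q = ≋-refl
*P-zeroˡ {a ∷ p} e q = ≋-trans
  (+P-cong (≋-trans (scaleP-cong (at e 0) (≋-refl {q})) (scaleP-0 q)) (∷-≋-[] refl (*P-zeroˡ (≋-tail-[] e) q)))
  ≋-refl

*P-congˡ : ∀ p {q q′} → q ≋ q′ → (p *P q) ≋ (p *P q′)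
*P-congˡ []      e = ≋-refl
*P-congˡ (a ∷ p) e = +P-cong (scaleP-cong {a} refl e) (∷-cong refl (*P-congˡ p e))

*P-congʳ : ∀ {p p′} → p ≋ p′ → ∀ q → (p *P q) ≋ (p′ *P q)
*P-congʳ {[]}    {p′}     e q = ≋-sym (*P-zeroˡ (≋-sym e) q)
*P-congʳ {a ∷ p} {[]}     e q = *P-zeroˡ e q
*P-congʳ {a ∷ p} {b ∷ p′} e q =
  +P-cong (scaleP-cong (at e 0) ≋-refl) (∷-cong refl (*P-congʳ (≋-tail e) q))

*P-cong : ∀ {p p′ q q′} → p ≋ p′ → q ≋ q′ → (p *P q) ≋ (p′ *P q′)
*P-cong {p′ = p′} {q = q} e f = ≋-trans (*P-congʳ e q) (*P-congˡ p′ f)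

*P-zeroʳ : ∀ p → (p *P []) ≋ []
*P-zeroʳ []      = ≋-refl
*P-zeroʳ (a ∷ p) = ∷-≋-[] refl (*P-zeroʳ p)

*P-distribʳ : ∀ r p q → ((p +P q) *P r) ≋ ((p *P r) +P (q *P r))
*P-distribʳ r []      q       = ≋-refl
*P-distribʳ r (a ∷ p) []      = ≋-sym (+P-identityʳ _)
*P-distribʳ r (a ∷ p) (b ∷ q) = ≋-trans
  (+P-cong (scaleP-distrib-+ a b r) (∷-cong refl (*P-distribʳ r p q)))
  (+P-interchange (scaleP a r) (scaleP b r) (0ℤ ∷ (p *P r)) (0ℤ ∷ (q *P r)))

-- `_*P_` recurses on its left factor; this is the mirror recursion on the right one, from which
-- commutativity follows by induction.
*P-∷ : ∀ p b q → (p *P (b ∷ q)) ≋ (scaleP b p +P (0ℤ ∷ (p *P q)))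
*P-∷ []      b q = ≋-sym (∷-≋-[] refl ≋-refl)
*P-∷ (a ∷ p) b q = ∷-cong (cong (ℤ._+ 0ℤ) (ℤₚ.*-comm a b)) (≋-trans
  (+P-cong (≋-refl {scaleP a q}) (*P-∷ p b q)) (≋-trans (≋-sym (+P-assoc (scaleP a q) (scaleP b p) (0ℤ ∷ (p *P q))))
  (≋-trans (+P-cong (+P-comm (scaleP a q) (scaleP b p)) ≋-refl) (+P-assoc (scaleP b p) (scaleP a q) (0ℤ ∷ (p *P q))))))

*P-comm : ∀ p q → (p *P q) ≋ (q *P p)
*P-comm []      q = ≋-sym (*P-zeroʳ q)
*P-comm (a ∷ p) q = ≋-trans (+P-cong (≋-refl {scaleP a q}) (∷-cong refl (*P-comm p q))) (≋-sym (*P-∷ q a p))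

*P-distribˡ : ∀ r p q → (r *P (p +P q)) ≋ ((r *P p) +P (r *P q))
*P-distribˡ r p q = ≋-trans (*P-comm r (p +P q))
  (≋-trans (*P-distribʳ r p q) (+P-cong (*P-comm p r) (*P-comm q r)))

scaleP-*P : ∀ c p q → (scaleP c p *P q) ≋ scaleP c (p *P q)
scaleP-*P c []      q = ≋-refl
scaleP-*P c (a ∷ p) q = ≋-trans
  (+P-cong (scaleP-scaleP c a q) (∷-cong (sym (ℤₚ.*-zeroʳ c)) (scaleP-*P c p q)))
  (≋-sym (scaleP-+P c (scaleP a q) (0ℤ ∷ (p *P q))))

shift-*P : ∀ p q → ((0ℤ ∷ p) *P q) ≋ (0ℤ ∷ (p *P q))
shift-*P p q = +P-cong (scaleP-0 q) (≋-refl {0ℤ ∷ (p *P q)})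

*P-assoc : ∀ p q r → ((p *P q) *P r) ≋ (p *P (q *P r))
*P-assoc []      q r = ≋-refl
*P-assoc (a ∷ p) q r = ≋-trans (*P-distribʳ r (scaleP a q) (0ℤ ∷ (p *P q)))
  (+P-cong (scaleP-*P a q r) (≋-trans (shift-*P (p *P q) r) (∷-cong refl (*P-assoc p q r))))

const-*P : ∀ c p → ([ c ] *P p) ≋ scaleP c p
const-*P c p = ≋-trans (+P-cong (≋-refl {scaleP c p}) (∷-≋-[] {p = []} refl ≋-refl)) (+P-identityʳ (scaleP c p))

*P-identityˡ : ∀ p → (oneP *P p) ≋ p
*P-identityˡ p = ≋-trans (const-*P 1ℤ p) (scaleP-1 p)

-- The commutative ring of polynomials and its solver, with integer coefficients

polyRing : CommutativeRing _ _
polyRing = record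
  { Carrier = Poly ; _≈_ = _≋_ ; _+_ = _+P_ ; _*_ = _*P_ ; -_ = negP ; 0# = [] ; 1# = oneP
  ; isCommutativeRing = record
    { isRing = record
      { +-isAbelianGroup = record
        { isGroup = record
          { isMonoid = record
            { isSemigroup = record
              { isMagma = record
                { isEquivalence = record { refl = ≋-refl ; sym = ≋-sym ; trans = ≋-trans }
                ; ∙-cong = +P-cong }
              ; assoc = +P-assoc }
            ; identity = (λ p → ≋-refl) , +P-identityʳ }
          ; inverse = +P-inverseˡ , +P-inverseʳ
          ; ⁻¹-cong = negP-cong }
        ; comm = +P-comm }
      ; *-cong = *P-cong
      ; *-assoc = *P-assoc
      ; *-identity = *P-identityˡ , (λ p → ≋-trans (*P-comm p oneP) (*P-identityˡ p))
      ; distrib = *P-distribˡ , *P-distribʳ }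
    ; *-comm = *P-comm } }

const-homo : CommutativeRing.rawRing ℤₚ.+-*-commutativeRing -Raw-AlmostCommutative⟶ fromCommutativeRing polyRing
const-homo = record
  { ⟦_⟧    = [_]
  ; +-homo = λ _ _ → ≋-refl
  ; *-homo = λ a b → ∷-cong (sym (ℤₚ.+-identityʳ (a ℤ.* b))) ≋-refl
  ; -‿homo = λ _ → ≋-refl
  ; 0-homo = ∷-≋-[] refl ≋-refl
  ; 1-homo = ≋-refl }

const-≟ : ∀ a b → Maybe ([ a ] ≋ [ b ])
const-≟ a b with a ℤ.≟ b
... | yes a≡b = just (∷-cong a≡b ≋-refl)
... | no  _   = nothing

open Algebra.Solver.Ring (CommutativeRing.rawRing ℤₚ.+-*-commutativeRing) (fromCommutativeRing polyRing) const-homo const-≟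
  using (solve; _:=_; _:+_; _:*_; _:-_; :-_; con)

module Poly = CommutativeRing polyRing
module ≋-Reasoning = SetoidReasoning Poly.setoid

-- Comparison with `_≈P_`, and absence of zero divisors

strip-≋ : ∀ p → strip p ≋ p
strip-≋ [] = ≋-refl
strip-≋ (a ∷ p) with strip p | strip-≋ p
... | b ∷ r | e = ∷-cong refl e
... | []    | e with a ℤ.≟ 0ℤ
...   | yes a≡0 = ≋-sym (∷-≋-[] a≡0 (≋-sym e))
...   | no  _   = ∷-cong refl e

strip-≋[] : ∀ {p} → p ≋ [] → strip p ≡ []
strip-≋[] {[]} e = refl
strip-≋[] {a ∷ p} e with strip p | strip-≋[] (≋-tail-[] e)
... | [] | _ with a ℤ.≟ 0ℤ
...   | yes _   = refl
...   | no  a≢0 = contradiction (at e 0) a≢0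

-P≋[]⇒≋ : ∀ {p q} → p -P q ≋ [] → p ≋ q
-P≋[]⇒≋ {p} {q} e = begin
  p                 ≈⟨ solve 2 (λ p q → p := (p :- q) :+ q) ≋-refl p q ⟩
  (p -P q) +P q     ≈⟨ +P-cong e (≋-refl {q}) ⟩
  q                 ∎
  where open ≋-Reasoning

≈P⇒≋ : ∀ {p q} → p ≈P q → p ≋ q
≈P⇒≋ {p} {q} e = -P≋[]⇒≋ (≋-trans (≋-sym (strip-≋ (p -P q))) (subst (_≋ []) (sym e) ≋-refl))

≋⇒≈P : ∀ {p q} → p ≋ q → p ≈P q
≋⇒≈P {p} {q} e = strip-≋[] (≋-trans (+P-cong e (≋-refl {negP q})) (+P-inverseʳ q))

-- Lowest coefficients decide: zeros at the front of `p` are shifted off, and once the constant term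
-- of `p` is nonzero the coefficients of `q` must vanish one after the other.
*P-integral : ∀ p q → p *P q ≋ [] → p ≋ [] ⊎ q ≋ []
*P-integral []      q e = inj₁ ≋-refl
*P-integral (a ∷ p) q e with a ℤ.≟ 0ℤ
... | yes refl with *P-integral p q (≋-tail-[] (≋-trans (≋-sym (shift-*P p q)) e))
...   | inj₁ p≋0 = inj₁ (∷-≋-[] refl p≋0)
...   | inj₂ q≋0 = inj₂ q≋0
*P-integral (a ∷ p) q e | no a≢0 = inj₂ (go q e)
  where
  go : ∀ q → (a ∷ p) *P q ≋ [] → q ≋ []
  go []      e = ≋-refl
  go (b ∷ q) e with ℤₚ.i*j≡0⇒i≡0∨j≡0 a (trans (sym (ℤₚ.+-identityʳ (a ℤ.* b))) (at e 0))
  ... | inj₁ a≡0  = contradiction a≡0 a≢0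
  ... | inj₂ refl = ∷-≋-[] refl (go q (≋-tail-[] (≋-trans
        (+P-cong (≋-sym (scaleP-0 (a ∷ p))) (≋-refl {0ℤ ∷ ((a ∷ p) *P q)}))
        (≋-trans (≋-sym (*P-∷ (a ∷ p) 0ℤ q)) e))))

*P-nonzeroˡ : ∀ {p q} → ¬ (p ≋ []) → p *P q ≋ [] → q ≋ []
*P-nonzeroˡ {p} {q} p≉0 e = Sum.[ (λ p≋0 → contradiction p≋0 p≉0) , (λ q≋0 → q≋0) ] (*P-integral p q e)

*P-cancelʳ : ∀ {p q} r → ¬ (r ≋ []) → p *P r ≋ q *P r → p ≋ q
*P-cancelʳ {p} {q} r r≉0 e = -P≋[]⇒≋ (*P-nonzeroˡ r≉0 (begin
  r *P (p -P q)       ≈⟨ solve 3 (λ p q r → r :* (p :- q) := p :* r :- q :* r) ≋-refl p q r ⟩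
  p *P r -P q *P r    ≈⟨ +P-cong e (≋-refl {negP (q *P r)}) ⟩
  q *P r -P q *P r    ≈⟨ +P-inverseʳ (q *P r) ⟩
  []                  ∎))
  where open ≋-Reasoning

const≉[] : ∀ {m} → m ≢ 0ℤ → ¬ ([ m ] ≋ [])
const≉[] m≢0 e = m≢0 (at e 0)

*P-≉[] : ∀ {p q} → ¬ (p ≋ []) → ¬ (q ≋ []) → ¬ (p *P q ≋ [])
*P-≉[] p≉0 q≉0 e = q≉0 (*P-nonzeroˡ p≉0 e)

-- Below d p says that deg p < d.
Below : ℕ → Poly → Set
Below d p = ∀ i → d ≤ i → coeff p i ≡ 0ℤ

Below-cong : ∀ {d p q} → p ≋ q → Below d p → Below d q
Below-cong e b i d≤i = trans (sym (at e i)) (b i d≤i)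

Below-length : ∀ p → Below (length p) p
Below-length []      i       _       = refl
Below-length (a ∷ p) (suc i) (s≤s l) = Below-length p i l

-- `d` and `e` only bound the degrees and need not equal them. `Below-*P` exploits this by raising
-- `e` to `i ∸ d`, where the coefficient of `q` is zero.
coeff-*P-top : ∀ p q d e → Below (suc d) p → Below (suc e) q →
               coeff (p *P q) (d ℕ.+ e) ≡ coeff p d ℤ.* coeff q e
coeff-*P-top []      q d       e bp bq = refl
coeff-*P-top (a ∷ p) q zero    e bp bq = trans (coeff-+P (scaleP a q) (0ℤ ∷ (p *P q)) e)
  (trans (cong₂ ℤ._+_ (coeff-scaleP a q e) (at shift≋0 e)) (ℤₚ.+-identityʳ _))
  where
  shift≋0 : 0ℤ ∷ (p *P q) ≋ []
  shift≋0 = ∷-≋-[] refl (*P-zeroˡ {p} (coeffwise λ i → bp (suc i) (s≤s z≤n)) q)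
coeff-*P-top (a ∷ p) q (suc d) e bp bq = trans (coeff-+P (scaleP a q) (0ℤ ∷ (p *P q)) (suc (d ℕ.+ e)))
  (trans (cong₂ ℤ._+_
    (trans (coeff-scaleP a q (suc (d ℕ.+ e)))
      (trans (cong (a ℤ.*_) (bq (suc (d ℕ.+ e)) (s≤s (ℕₚ.m≤n+m e d)))) (ℤₚ.*-zeroʳ a)))
    (coeff-*P-top p q d e (λ i l → bp (suc i) (s≤s l)) bq)) (ℤₚ.+-identityˡ _))

Below-*P : ∀ p q d e → Below (suc d) p → Below (suc e) q → Below (suc (d ℕ.+ e)) (p *P q)
Below-*P p q d e bp bq i l = trans (cong (coeff (p *P q)) (sym d+e′≡i))
  (trans (coeff-*P-top p q d (i ∸ d) bp (λ j l′ → bq j (ℕₚ.≤-trans (ℕₚ.m≤n⇒m≤1+n e<e′) l′)))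
  (trans (cong (coeff p d ℤ.*_) (bq (i ∸ d) e<e′)) (ℤₚ.*-zeroʳ (coeff p d))))
  where
  e<e′ : e < i ∸ d
  e<e′ = ℕₚ.m+n≤o⇒m≤o∸n (suc e) (subst (_≤ i) (cong suc (ℕₚ.+-comm d e)) l)
  d+e′≡i : d ℕ.+ (i ∸ d) ≡ i
  d+e′≡i = ℕₚ.m+[n∸m]≡n (ℕₚ.≤-trans (ℕₚ.m≤n⇒m≤1+n (ℕₚ.m≤m+n d e)) l)

leading : ∀ p → p ≋ [] ⊎ (∃ λ e → coeff p e ≢ 0ℤ × Below (suc e) p)
leading [] = inj₁ ≋-refl
leading (a ∷ p) with leading p
... | inj₂ (e , p≢0 , b) = inj₂ (suc e , p≢0 , λ { (suc i) (s≤s l) → b i l })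
... | inj₁ p≋0 with a ℤ.≟ 0ℤ
...   | yes a≡0 = inj₁ (∷-≋-[] a≡0 p≋0)
...   | no  a≢0 = inj₂ (0 , a≢0 , λ { (suc i) _ → at p≋0 i })

record Monic (d : ℕ) (p : Poly) : Set where
  constructor monic
  field
    leading-coeff : coeff p d ≡ 1ℤ
    degree-bound  : Below (suc d) p

Monic-*P : ∀ {d e p q} → Monic d p → Monic e q → Monic (d ℕ.+ e) (p *P q)
Monic-*P {d} {e} {p} {q} (monic p₁ bp) (monic q₁ bq) =
  monic (trans (coeff-*P-top p q d e bp bq) (cong₂ ℤ._*_ p₁ q₁)) (Below-*P p q d e bp bq)

Monic-≉[] : ∀ {d p} → Monic d p → ¬ (p ≋ [])
Monic-≉[] {d} (monic p₁ _) e with trans (sym p₁) (at e d)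
... | ()

X^-+ : ∀ m n → X^ (m ℕ.+ n) ≋ X^ m *P X^ n
X^-+ zero    n = ≋-sym (*P-identityˡ (X^ n))
X^-+ (suc m) n = ≋-trans (∷-cong refl (X^-+ m n)) (≋-sym (shift-*P (X^ m) (X^ n)))

++-last : ∀ p c → p ++ [ c ] ≋ p +P [ c ] *P X^ (length p)
++-last []      c = ∷-cong (trans (sym (ℤₚ.*-identityʳ c)) (sym (ℤₚ.+-identityʳ _))) ≋-refl
++-last (a ∷ p) c = ≋-trans (∷-cong (sym (trans (cong (λ z → a ℤ.+ (z ℤ.+ 0ℤ)) (ℤₚ.*-zeroʳ c)) (ℤₚ.+-identityʳ a))) (++-last p c))
  (+P-cong (≋-refl {a ∷ p}) (∷-cong refl shift))
  where
  shift : [ c ] *P X^ (length p) ≋ scaleP c (X^ (length p)) +P []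
  shift = ≋-trans (const-*P c (X^ (length p))) (≋-sym (+P-identityʳ _))

reverse-∷ : ∀ c r → reverse (c ∷ r) ≋ reverse r +P [ c ] *P X^ (length r)
reverse-∷ c r rewrite Listₚ.unfold-reverse c r | sym (Listₚ.length-reverse r) = ++-last (reverse r) c

-- Division by monic polynomials

-- divMonic and cyclotomic are built from private functions. The unification of both sides of
-- divMonic-divHigh (after abstracting the public functions occurring in it) solves divHigh to the
-- private long division; sub, lastOf, cyc and prodDiv are recovered in the same way.
mutual
  divHigh : ℕ → List ℤ → List ℤ → List ℤ
  divHigh = _

  divMonic-divHigh : ∀ f g → divMonic f g
    ≡ reverse (divHigh (length (reverse (strip f))) (reverse (strip f)) (reverse (strip g)))
  divMonic-divHigh f g with reverse {A = ℤ}
  ... | rev with rev (strip f) | rev (strip g)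
  ... | fh | gh with length fh
  ... | k = refl

mutual
  sub : List ℤ → List ℤ → List ℤ
  sub = _

  divHigh-step : ∀ k c rest x gt → length gt ≤ length rest →
    divHigh (suc k) (c ∷ rest) (x ∷ gt) ≡ c ∷ divHigh k (sub rest (map (c ℤ.*_) gt)) (x ∷ gt)
  divHigh-step k c rest x gt le with length gt ℕ.≤? length rest
  ... | no ≰ = contradiction le ≰
  -- With the mapped list abstracted, both arguments of `sub` are variables, so its metavariable can
  -- be solved.
  ... | yes _ with map (c ℤ.*_) gt
  ...   | cg = refl

length-sub : ∀ r cs → length cs ≤ length r → length (sub r cs) ≡ length r
length-sub r       []       _       = refl
length-sub (a ∷ r) (c ∷ cs) (s≤s l) = cong suc (length-sub r cs l)

-- Subtraction of high-degree-first lists aligns the leading ends; on polynomials this multiplies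
-- the subtrahend by `X^ k`, where `k` is the difference of the lengths.
reverse-sub : ∀ r cs k → length r ≡ k ℕ.+ length cs →
              reverse (sub r cs) ≋ reverse r -P X^ k *P reverse cs
reverse-sub r [] k _ = ≋-sym (≋-trans (+P-cong (≋-refl {reverse r}) (negP-cong (*P-zeroʳ (X^ k))))
  (+P-identityʳ (reverse r)))
reverse-sub [] (c ∷ cs) k eq with trans eq (ℕₚ.+-suc k (length cs))
... | ()
reverse-sub (a ∷ r) (c ∷ cs) k eq = begin
  reverse ((a ℤ.- c) ∷ sub r cs)
    ≈⟨ reverse-∷ (a ℤ.- c) (sub r cs) ⟩
  reverse (sub r cs) +P [ a ℤ.- c ] *P X^ (length (sub r cs))
    ≡⟨ cong (λ l → reverse (sub r cs) +P [ a ℤ.- c ] *P X^ l) (length-sub r cs len≤) ⟩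
  reverse (sub r cs) +P [ a ℤ.- c ] *P X^ (length r)
    ≈⟨ +P-cong (reverse-sub r cs k len) (≋-refl {[ a ℤ.- c ] *P X^ (length r)}) ⟩
  (reverse r -P X^ k *P reverse cs) +P [ a ℤ.- c ] *P X^ (length r)
    ≈⟨ solve 6 (λ r x s a c l → (r :- x :* s) :+ (a :- c) :* l := (r :+ a :* l) :- (x :* s :+ c :* l)) ≋-refl
         (reverse r) (X^ k) (reverse cs) [ a ] [ c ] (X^ (length r)) ⟩
  (reverse r +P [ a ] *P X^ (length r)) -P (X^ k *P reverse cs +P [ c ] *P X^ (length r))
    ≈⟨ +P-cong (≋-sym (reverse-∷ a r)) (negP-cong (+P-cong (≋-refl {X^ k *P reverse cs})
         (*P-congˡ [ c ] (≋-trans (Poly.reflexive (cong X^ len)) (X^-+ k (length cs)))))) ⟩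
  reverse (a ∷ r) -P (X^ k *P reverse cs +P [ c ] *P (X^ k *P X^ (length cs)))
    ≈⟨ solve 5 (λ r x s c l → r :- (x :* s :+ c :* (x :* l)) := r :- x :* (s :+ c :* l)) ≋-refl
         (reverse (a ∷ r)) (X^ k) (reverse cs) [ c ] (X^ (length cs)) ⟩
  reverse (a ∷ r) -P X^ k *P (reverse cs +P [ c ] *P X^ (length cs))
    ≈⟨ +P-cong (≋-refl {reverse (a ∷ r)}) (negP-cong (*P-congˡ (X^ k) (≋-sym (reverse-∷ c cs)))) ⟩
  reverse (a ∷ r) -P X^ k *P reverse (c ∷ cs) ∎
  where
  open ≋-Reasoning
  len : length r ≡ k ℕ.+ length cs
  len = ℕₚ.suc-injective (trans eq (ℕₚ.+-suc k (length cs)))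
  len≤ : length cs ≤ length r
  len≤ = subst (length cs ≤_) (sym len) (ℕₚ.m≤n+m (length cs) k)

-- The length of the quotient list is part of the induction because reversal turns it into an
-- exponent: the next quotient entry `c` stands for `c` times `X^` of the length of the entries
-- after it.
divHigh-correct : ∀ k h gt → length h ≤ k → ∃ λ r → Below (length gt) r
  × reverse h ≋ reverse (divHigh k h (1ℤ ∷ gt)) *P reverse (1ℤ ∷ gt) +P r
  × length (divHigh k h (1ℤ ∷ gt)) ≡ length h ∸ length gt
divHigh-correct zero    [] gt _ = [] , (λ _ _ → refl) , ≋-refl , sym (ℕₚ.0∸n≡0 (length gt))
divHigh-correct (suc k) [] gt _ = [] , (λ _ _ → refl) , ≋-refl , sym (ℕₚ.0∸n≡0 (length gt))
divHigh-correct (suc k) (c ∷ rest) gt (s≤s l) with length gt ℕ.≤? length rest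
... | no gt≰rest =
  reverse (c ∷ rest)
  , (λ i gt≤i → Below-length (reverse (c ∷ rest)) i
      (subst (_≤ i) (sym (Listₚ.length-reverse (c ∷ rest))) (ℕₚ.≤-trans (ℕₚ.≰⇒> gt≰rest) gt≤i)))
  , ≋-refl
  , sym (ℕₚ.m≤n⇒m∸n≡0 (ℕₚ.≰⇒> gt≰rest))
... | yes gt≤rest = r , r-below , eq , len
  where
  open ≋-Reasoning
  cgt = map (c ℤ.*_) gt
  rest′ = sub rest cgt
  cgt≤rest : length cgt ≤ length rest
  cgt≤rest = subst (_≤ length rest) (sym (Listₚ.length-map (c ℤ.*_) gt)) gt≤rest
  len-rest′ : length rest′ ≡ length rest
  len-rest′ = length-sub rest cgt cgt≤rest
  ih = divHigh-correct k rest′ gt (subst (_≤ k) (sym len-rest′) l)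
  r = proj₁ ih
  r-below = proj₁ (proj₂ ih)
  quot = divHigh k rest′ (1ℤ ∷ gt)
  e = length rest ∸ length gt
  len-quot : length quot ≡ e
  len-quot = trans (proj₂ (proj₂ (proj₂ ih))) (cong (_∸ length gt) len-rest′)
  len : suc (length quot) ≡ suc (length rest) ∸ length gt
  len = trans (cong suc len-quot) (sym (ℕₚ.+-∸-assoc 1 gt≤rest))
  rest-split : length rest ≡ e ℕ.+ length gt
  rest-split = sym (ℕₚ.m∸n+n≡m gt≤rest)
  reverse-cgt : reverse cgt ≋ [ c ] *P reverse gt
  reverse-cgt = ≋-trans (Poly.reflexive (sym (Listₚ.reverse-map (c ℤ.*_) gt))) (≋-sym (const-*P c (reverse gt)))
  reverse-rest′ : reverse rest′ ≋ reverse rest -P X^ e *P ([ c ] *P reverse gt)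
  reverse-rest′ = ≋-trans
    (reverse-sub rest cgt e (trans rest-split (cong (e ℕ.+_) (sym (Listₚ.length-map (c ℤ.*_) gt)))))
    (+P-cong (≋-refl {reverse rest}) (negP-cong (*P-congˡ (X^ e) reverse-cgt)))
  g = reverse (1ℤ ∷ gt)
  g-split : g ≋ reverse gt +P X^ (length gt)
  g-split = ≋-trans (reverse-∷ 1ℤ gt) (+P-cong (≋-refl {reverse gt}) (*P-identityˡ (X^ (length gt))))
  eq : reverse (c ∷ rest) ≋ reverse (c ∷ quot) *P g +P r
  eq = begin
    reverse (c ∷ rest)
      ≈⟨ reverse-∷ c rest ⟩
    reverse rest +P [ c ] *P X^ (length rest)
      ≈⟨ +P-cong (≋-refl {reverse rest})
           (*P-congˡ [ c ] (≋-trans (Poly.reflexive (cong X^ rest-split)) (X^-+ e (length gt)))) ⟩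
    reverse rest +P [ c ] *P (X^ e *P X^ (length gt))
      ≈⟨ solve 5 (λ s c x l g → s :+ c :* (x :* l) := (s :- x :* (c :* g)) :+ c :* x :* (g :+ l)) ≋-refl
           (reverse rest) [ c ] (X^ e) (X^ (length gt)) (reverse gt) ⟩
    (reverse rest -P X^ e *P ([ c ] *P reverse gt)) +P [ c ] *P X^ e *P (reverse gt +P X^ (length gt))
      ≈⟨ +P-cong (≋-trans (≋-sym reverse-rest′) (proj₁ (proj₂ (proj₂ ih))))
           (*P-congˡ ([ c ] *P X^ e) (≋-sym g-split)) ⟩
    (reverse quot *P g +P r) +P [ c ] *P X^ e *P g
      ≈⟨ solve 4 (λ q g r y → (q :* g :+ r) :+ y :* g := (q :+ y) :* g :+ r) ≋-refl
           (reverse quot) g r ([ c ] *P X^ e) ⟩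
    (reverse quot +P [ c ] *P X^ e) *P g +P r
      ≈⟨ +P-cong (*P-congʳ (≋-trans (Poly.reflexive (cong (λ j → reverse quot +P [ c ] *P X^ j) (sym len-quot)))
           (≋-sym (reverse-∷ c quot))) g) (≋-refl {r}) ⟩
    reverse (c ∷ quot) *P g +P r ∎

strip-last : ∀ p → strip p ≡ [] ⊎ (∃₂ λ xs c → strip p ≡ xs ++ [ c ] × c ≢ 0ℤ)
strip-last [] = inj₁ refl
strip-last (a ∷ p) with strip p | strip-last p
... | b ∷ r | inj₂ (xs , c , eq , c≢0) = inj₂ (a ∷ xs , c , cong (a ∷_) eq , c≢0)
... | [] | _ with a ℤ.≟ 0ℤ
...   | yes _   = inj₁ refl
...   | no  a≢0 = inj₂ ([] , a , refl , a≢0)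

coeff-++-last : ∀ xs c → coeff (xs ++ [ c ]) (length xs) ≡ c
coeff-++-last []       c = refl
coeff-++-last (x ∷ xs) c = coeff-++-last xs c

Below-++-last : ∀ xs c → Below (suc (length xs)) (xs ++ [ c ])
Below-++-last []       c (suc i) _       = refl
Below-++-last (x ∷ xs) c (suc i) (s≤s l) = Below-++-last xs c i l

reverse-strip-Monic : ∀ {d g} → Monic d g → ∃ λ gt → reverse (strip g) ≡ 1ℤ ∷ gt × length gt ≡ d
reverse-strip-Monic {d} {g} (monic g₁ bg) with strip g | strip-≋ g | strip-last g
... | _ | e | inj₁ refl = contradiction e λ e → Monic-≉[] (monic g₁ bg) (≋-sym e)
... | _ | e | inj₂ (xs , c , refl , c≢0) =
  reverse xs , trans (Listₚ.reverse-++ xs [ c ]) (cong (_∷ reverse xs) c≡1) , trans (Listₚ.length-reverse xs) len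
  where
  len : length xs ≡ d
  len with ℕₚ.<-cmp (length xs) d
  ... | tri≈ _ eq _ = eq
  ... | tri< lt _ _ = contradiction
          (trans (sym g₁) (trans (sym (at e d)) (Below-++-last xs c d lt))) λ ()
  ... | tri> _ _ gt = contradiction
          (trans (sym (coeff-++-last xs c)) (trans (at e (length xs)) (bg (length xs) gt))) c≢0
  c≡1 : c ≡ 1ℤ
  c≡1 = trans (sym (coeff-++-last xs c)) (trans (at e (length xs)) (trans (cong (coeff g) len) g₁))

-- The quotient s − m·(f div g) vanishes: otherwise its product with the monic g
-- would have degree at least deg g, but that product is m times the remainder.
divMonic-exact : ∀ {d m} f g s → Monic d g → m ≢ 0ℤ → [ m ] *P f ≋ s *P g → f ≋ divMonic f g *P g
divMonic-exact {d} {m} f g s (monic g₁ bg) m≢0 div = begin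
  f           ≈⟨ f-split ⟩
  D *P g +P r ≈⟨ +P-cong (≋-refl {D *P g}) r≋0 ⟩
  D *P g +P [] ≈⟨ +P-identityʳ (D *P g) ⟩
  D *P g      ∎
  where
  open ≋-Reasoning
  D = divMonic f g
  shape-g = reverse-strip-Monic {g = g} (monic g₁ bg)
  gt = proj₁ shape-g
  fh = reverse (strip f)
  dh = divHigh-correct (length fh) fh gt ℕₚ.≤-refl
  r = proj₁ dh
  D-eq : D ≡ reverse (divHigh (length fh) fh (1ℤ ∷ gt))
  D-eq = trans (divMonic-divHigh f g) (cong (λ gh → reverse (divHigh (length fh) fh gh)) (proj₁ (proj₂ shape-g)))
  g-eq : reverse (1ℤ ∷ gt) ≋ g
  g-eq = ≋-trans (Poly.reflexive (trans (cong reverse (sym (proj₁ (proj₂ shape-g)))) (Listₚ.reverse-involutive (strip g))))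
    (strip-≋ g)
  f-split : f ≋ D *P g +P r
  f-split = begin
    f           ≈⟨ ≋-sym (strip-≋ f) ⟩
    strip f     ≡⟨ sym (Listₚ.reverse-involutive (strip f)) ⟩
    reverse fh  ≈⟨ proj₁ (proj₂ (proj₂ dh)) ⟩
    reverse (divHigh (length fh) fh (1ℤ ∷ gt)) *P reverse (1ℤ ∷ gt) +P r
      ≈⟨ +P-cong (*P-cong (Poly.reflexive (sym D-eq)) g-eq) (≋-refl {r}) ⟩
    D *P g +P r ∎
  w = s -P [ m ] *P D
  w*g : w *P g ≋ [ m ] *P r
  w*g = begin
    (s -P [ m ] *P D) *P g        ≈⟨ solve 4 (λ s m d g → (s :- m :* d) :* g := s :* g :- m :* (d :* g)) ≋-refl s [ m ] D g ⟩
    s *P g -P [ m ] *P (D *P g)   ≈⟨ +P-cong (≋-trans (≋-sym div) (*P-congˡ [ m ] f-split)) (≋-refl {negP ([ m ] *P (D *P g))}) ⟩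
    [ m ] *P (D *P g +P r) -P [ m ] *P (D *P g)
      ≈⟨ solve 3 (λ m x r → m :* (x :+ r) :- m :* x := m :* r) ≋-refl [ m ] (D *P g) r ⟩
    [ m ] *P r ∎
  below-mr : Below d ([ m ] *P r)
  below-mr i d≤i = trans (at (const-*P m r) i) (trans (coeff-scaleP m r i)
    (trans (cong (m ℤ.*_) (proj₁ (proj₂ dh) i (subst (_≤ i) (sym (proj₂ (proj₂ shape-g))) d≤i))) (ℤₚ.*-zeroʳ m)))
  w≋0 : w ≋ []
  w≋0 with leading w
  ... | inj₁ e = e
  ... | inj₂ (e , w≢0 , bw) = contradiction (coeff≡0 e bw) w≢0
    where
    coeff≡0 : ∀ e → Below (suc e) w → coeff w e ≡ 0ℤ
    coeff≡0 e bw = trans (sym (ℤₚ.*-identityʳ _)) (trans (cong (coeff w e ℤ.*_) (sym g₁))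
      (trans (sym (coeff-*P-top w g e d bw bg)) (trans (at w*g (e ℕ.+ d)) (below-mr (e ℕ.+ d) (ℕₚ.m≤n+m d e)))))
  r≋0 : r ≋ []
  r≋0 = *P-nonzeroˡ (const≉[] m≢0) (≋-trans (≋-sym w*g) (*P-zeroˡ {w} w≋0 g))

-- Divisibility over ℚ and coprimality

const-*-homo : ∀ a b → [ a ℤ.* b ] ≋ [ a ] *P [ b ]
const-*-homo a b = ∷-cong (sym (ℤₚ.+-identityʳ (a ℤ.* b))) ≋-refl

*-≢0 : ∀ {a b} → a ≢ 0ℤ → b ≢ 0ℤ → a ℤ.* b ≢ 0ℤ
*-≢0 {a} a≢0 b≢0 e = Sum.[ a≢0 , b≢0 ] (ℤₚ.i*j≡0⇒i≡0∨j≡0 a e)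

-- Divisibility in ℚ[q]: only a nonzero integer multiple of a need be divisible in ℤ[q].
infix 4 _∣ˢ_
record _∣ˢ_ (p a : Poly) : Set where
  constructor dividesˢ
  field
    scalar   : ℤ
    scalar≢0 : scalar ≢ 0ℤ
    quotient : Poly
    equality : [ scalar ] *P a ≋ quotient *P p

∣ˢ-factor : ∀ {p a} t → a ≋ t *P p → p ∣ˢ a
∣ˢ-factor {p} {a} t e = dividesˢ 1ℤ (λ ()) t (≋-trans (*P-identityˡ a) e)

∣ˢ-cong : ∀ {p a b} → a ≋ b → p ∣ˢ a → p ∣ˢ b
∣ˢ-cong e (dividesˢ m m≢0 t eq) = dividesˢ m m≢0 t (≋-trans (*P-congˡ [ m ] (≋-sym e)) eq)

∣ˢ-congˡ : ∀ {p q a} → p ≋ q → p ∣ˢ a → q ∣ˢ a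
∣ˢ-congˡ e (dividesˢ m m≢0 t eq) = dividesˢ m m≢0 t (≋-trans eq (*P-congˡ t e))

∣ˢ-+P : ∀ {p a b} → p ∣ˢ a → p ∣ˢ b → p ∣ˢ a +P b
∣ˢ-+P {p} {a} {b} (dividesˢ m m≢0 t eq) (dividesˢ m′ m′≢0 t′ eq′) =
  dividesˢ (m ℤ.* m′) (*-≢0 m≢0 m′≢0) ([ m′ ] *P t +P [ m ] *P t′) (begin
    [ m ℤ.* m′ ] *P (a +P b)       ≈⟨ *P-congʳ (const-*-homo m m′) (a +P b) ⟩
    [ m ] *P [ m′ ] *P (a +P b)    ≈⟨ solve 4 (λ m n a b → m :* n :* (a :+ b) := n :* (m :* a) :+ m :* (n :* b)) ≋-refl
                                        [ m ] [ m′ ] a b ⟩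
    [ m′ ] *P ([ m ] *P a) +P [ m ] *P ([ m′ ] *P b)
                                   ≈⟨ +P-cong (*P-congˡ [ m′ ] eq) (*P-congˡ [ m ] eq′) ⟩
    [ m′ ] *P (t *P p) +P [ m ] *P (t′ *P p)
                                   ≈⟨ solve 5 (λ m n t u p → n :* (t :* p) :+ m :* (u :* p) := (n :* t :+ m :* u) :* p) ≋-refl
                                        [ m ] [ m′ ] t t′ p ⟩
    ([ m′ ] *P t +P [ m ] *P t′) *P p ∎)
  where open ≋-Reasoning

∣ˢ-*P : ∀ {p a} c → p ∣ˢ a → p ∣ˢ c *P a
∣ˢ-*P {p} {a} c (dividesˢ m m≢0 t eq) = dividesˢ m m≢0 (c *P t) (begin
  [ m ] *P (c *P a)  ≈⟨ solve 3 (λ m c a → m :* (c :* a) := c :* (m :* a)) ≋-refl [ m ] c a ⟩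
  c *P ([ m ] *P a)  ≈⟨ *P-congˡ c eq ⟩
  c *P (t *P p)      ≈⟨ ≋-sym (*P-assoc c t p) ⟩
  c *P t *P p        ∎)
  where open ≋-Reasoning

record Coprime (a p : Poly) : Set where
  constructor bezout
  field
    u v        : Poly
    constant   : ℤ
    constant≢0 : constant ≢ 0ℤ
    identity   : u *P a +P v *P p ≋ [ constant ]

Coprime⇒CoprimeP : ∀ {a p} → Coprime a p → CoprimeP a p
Coprime⇒CoprimeP (bezout u v m m≢0 eq) = u , v , m , m≢0 , ≋⇒≈P eq

Coprime-sym : ∀ {a b} → Coprime a b → Coprime b a
Coprime-sym {a} {b} (bezout u v m m≢0 eq) = bezout v u m m≢0 (≋-trans (+P-comm (v *P b) (u *P a)) eq)

Coprime-cong : ∀ {a b p} → a ≋ b → Coprime a p → Coprime b p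
Coprime-cong {p = p} e (bezout u v m m≢0 eq) =
  bezout u v m m≢0 (≋-trans (+P-cong (*P-congˡ u (≋-sym e)) (≋-refl {v *P p})) eq)

Coprime-*P : ∀ {a b p} → Coprime a p → Coprime b p → Coprime (a *P b) p
Coprime-*P {a} {b} {p} (bezout u v m m≢0 eq) (bezout u′ v′ m′ m′≢0 eq′) =
  bezout (u *P u′) (u *P a *P v′ +P v *P (u′ *P b +P v′ *P p)) (m ℤ.* m′) (*-≢0 m≢0 m′≢0) (begin
    u *P u′ *P (a *P b) +P (u *P a *P v′ +P v *P (u′ *P b +P v′ *P p)) *P p
      ≈⟨ solve 7 (λ u a v x b y p → u :* x :* (a :* b) :+ (u :* a :* y :+ v :* (x :* b :+ y :* p)) :* p
                    := (u :* a :+ v :* p) :* (x :* b :+ y :* p)) ≋-refl u a v u′ b v′ p ⟩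
    (u *P a +P v *P p) *P (u′ *P b +P v′ *P p) ≈⟨ *P-cong eq eq′ ⟩
    [ m ] *P [ m′ ]                            ≈⟨ ≋-sym (const-*-homo m m′) ⟩
    [ m ℤ.* m′ ]                               ∎)
  where open ≋-Reasoning

Coprime-factor : ∀ {b p} a → Coprime (a *P b) p → Coprime b p
Coprime-factor {b} {p} a (bezout u v m m≢0 eq) =
  bezout (u *P a) v m m≢0 (≋-trans (+P-cong (*P-assoc u a b) (≋-refl {v *P p})) eq)

Coprime-const : ∀ {m} p → m ≢ 0ℤ → Coprime [ m ] p
Coprime-const {m} p m≢0 = bezout oneP [] m m≢0 (≋-trans (+P-identityʳ (oneP *P [ m ])) (*P-identityˡ [ m ]))

Coprime-resp-∣ˢ : ∀ {a b p} → p ∣ˢ a -P b → Coprime b p → Coprime a p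
Coprime-resp-∣ˢ {a} {b} {p} (dividesˢ k k≢0 t eq) (bezout u v m m≢0 eq′) =
  bezout (u *P [ k ]) ([ k ] *P v -P u *P t) (k ℤ.* m) (*-≢0 k≢0 m≢0) (begin
    u *P [ k ] *P a +P ([ k ] *P v -P u *P t) *P p
      ≈⟨ solve 7 (λ u k a v t p b → u :* k :* a :+ (k :* v :- u :* t) :* p
                    := k :* (u :* b :+ v :* p) :+ u :* (k :* (a :- b) :- t :* p)) ≋-refl u [ k ] a v t p b ⟩
    [ k ] *P (u *P b +P v *P p) +P u *P ([ k ] *P (a -P b) -P t *P p)
      ≈⟨ +P-cong (*P-congˡ [ k ] eq′) (*P-congˡ u (≋-trans (+P-cong eq (≋-refl {negP (t *P p)})) (+P-inverseʳ (t *P p)))) ⟩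
    [ k ] *P [ m ] +P u *P [] ≈⟨ +P-cong (≋-refl {[ k ] *P [ m ]}) (*P-zeroʳ u) ⟩
    [ k ] *P [ m ] +P []      ≈⟨ +P-identityʳ ([ k ] *P [ m ]) ⟩
    [ k ] *P [ m ]            ≈⟨ ≋-sym (const-*-homo k m) ⟩
    [ k ℤ.* m ]               ∎)
  where open ≋-Reasoning

Coprime-∣ˢ-cancel : ∀ {a x p} → Coprime a p → p ∣ˢ a *P x → p ∣ˢ x
Coprime-∣ˢ-cancel {a} {x} {p} (bezout u v m m≢0 eq′) (dividesˢ k k≢0 t eq) =
  dividesˢ (k ℤ.* m) (*-≢0 k≢0 m≢0) (u *P t +P [ k ] *P v *P x) (begin
    [ k ℤ.* m ] *P x   ≈⟨ *P-congʳ (≋-trans (const-*-homo k m) (*P-congˡ [ k ] (≋-sym eq′))) x ⟩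
    [ k ] *P (u *P a +P v *P p) *P x
      ≈⟨ solve 6 (λ k u a v p x → k :* (u :* a :+ v :* p) :* x := u :* (k :* (a :* x)) :+ k :* v :* x :* p) ≋-refl
           [ k ] u a v p x ⟩
    u *P ([ k ] *P (a *P x)) +P [ k ] *P v *P x *P p
      ≈⟨ +P-cong (≋-trans (*P-congˡ u eq) (≋-sym (*P-assoc u t p))) (≋-refl {[ k ] *P v *P x *P p}) ⟩
    u *P t *P p +P [ k ] *P v *P x *P p ≈⟨ ≋-sym (*P-distribʳ p (u *P t) ([ k ] *P v *P x)) ⟩
    (u *P t +P [ k ] *P v *P x) *P p ∎)
  where open ≋-Reasoning

-- The Bézout identity multiplied by `f` has two summands, and each is divisible by `a *P b`.
Coprime-∣ˢ-*P : ∀ {a b f} → Coprime a b → a ∣ˢ f → b ∣ˢ f → a *P b ∣ˢ f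
Coprime-∣ˢ-*P {a} {b} {f} (bezout u v c c≢0 eq) (dividesˢ k k≢0 s eqa) (dividesˢ l l≢0 t eqb) =
  dividesˢ (c ℤ.* (k ℤ.* l)) (*-≢0 c≢0 (*-≢0 k≢0 l≢0)) (u *P [ k ] *P t +P v *P [ l ] *P s) (begin
    [ c ℤ.* (k ℤ.* l) ] *P f
      ≈⟨ *P-congʳ (≋-trans (const-*-homo c (k ℤ.* l)) (*P-cong (≋-sym eq) (const-*-homo k l))) f ⟩
    (u *P a +P v *P b) *P ([ k ] *P [ l ]) *P f
      ≈⟨ solve 7 (λ u a v b k l f → (u :* a :+ v :* b) :* (k :* l) :* f
                    := u :* k :* a :* (l :* f) :+ v :* l :* b :* (k :* f)) ≋-refl u a v b [ k ] [ l ] f ⟩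
    u *P [ k ] *P a *P ([ l ] *P f) +P v *P [ l ] *P b *P ([ k ] *P f)
      ≈⟨ +P-cong (*P-congˡ (u *P [ k ] *P a) eqb) (*P-congˡ (v *P [ l ] *P b) eqa) ⟩
    u *P [ k ] *P a *P (t *P b) +P v *P [ l ] *P b *P (s *P a)
      ≈⟨ solve 8 (λ u a v b k l s t → u :* k :* a :* (t :* b) :+ v :* l :* b :* (s :* a)
                    := (u :* k :* t :+ v :* l :* s) :* (a :* b)) ≋-refl u a v b [ k ] [ l ] s t ⟩
    (u *P [ k ] *P t +P v *P [ l ] *P s) *P (a *P b) ∎)
  where open ≋-Reasoning

record Mod (p a b : Poly) : Set where
  constructor congruent
  field divisible : p ∣ˢ a -P b
open Mod

module _ {p : Poly} where
  ≋⇒Mod : ∀ {a b} → a ≋ b → Mod p a b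
  ≋⇒Mod {a} {b} e = congruent (∣ˢ-factor [] (≋-trans (+P-cong e (≋-refl {negP b})) (+P-inverseʳ b)))

  Mod-sym : ∀ {a b} → Mod p a b → Mod p b a
  Mod-sym {a} {b} (congruent d) =
    congruent (∣ˢ-cong (solve 2 (λ a b → con (ℤ.- 1ℤ) :* (a :- b) := b :- a) ≋-refl a b) (∣ˢ-*P [ ℤ.- 1ℤ ] d))

  Mod-trans : ∀ {a b c} → Mod p a b → Mod p b c → Mod p a c
  Mod-trans {a} {b} {c} (congruent d) (congruent d′) =
    congruent (∣ˢ-cong (solve 3 (λ a b c → (a :- b) :+ (b :- c) := a :- c) ≋-refl a b c) (∣ˢ-+P d d′))

  Mod-+P : ∀ {a a′ b b′} → Mod p a a′ → Mod p b b′ → Mod p (a +P b) (a′ +P b′)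
  Mod-+P {a} {a′} {b} {b′} (congruent d) (congruent d′) = congruent (∣ˢ-cong
    (solve 4 (λ a x b y → (a :- x) :+ (b :- y) := (a :+ b) :- (x :+ y)) ≋-refl a a′ b b′) (∣ˢ-+P d d′))

  Mod-*P : ∀ {a a′ b b′} → Mod p a a′ → Mod p b b′ → Mod p (a *P b) (a′ *P b′)
  Mod-*P {a} {a′} {b} {b′} (congruent d) (congruent d′) = congruent (∣ˢ-cong
    (solve 4 (λ a x b y → b :* (a :- x) :+ x :* (b :- y) := a :* b :- x :* y) ≋-refl a a′ b b′)
    (∣ˢ-+P (∣ˢ-*P b d) (∣ˢ-*P a′ d′)))

  Mod-negP : ∀ {a b} → Mod p a b → Mod p (negP a) (negP b)
  Mod-negP {a} {b} (congruent d) = congruent (∣ˢ-cong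
    (solve 2 (λ a b → con (ℤ.- 1ℤ) :* (a :- b) := (:- a) :- (:- b)) ≋-refl a b) (∣ˢ-*P [ ℤ.- 1ℤ ] d))

  Mod-powP : ∀ {a b} → Mod p a b → ∀ k → Mod p (powP a k) (powP b k)
  Mod-powP e zero    = ≋⇒Mod ≋-refl
  Mod-powP e (suc k) = Mod-*P (Mod-powP e k) e

  Mod-cancel : ∀ {a x y} → Coprime a p → Mod p (a *P x) (a *P y) → Mod p x y
  Mod-cancel {a} {x} {y} c (congruent d) = congruent (Coprime-∣ˢ-cancel c
    (∣ˢ-cong (solve 3 (λ a x y → a :* x :- a :* y := a :* (x :- y)) ≋-refl a x y) d))

Mod-setoid : Poly → Setoid _ _
Mod-setoid p = record { _≈_ = Mod p ; isEquivalence = record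
  { refl = ≋⇒Mod ≋-refl ; sym = Mod-sym ; trans = Mod-trans } }

module Mod-Reasoning (p : Poly) = SetoidReasoning (Mod-setoid p)

-- Powers and geometric sums

powP-cong : ∀ {p q} → p ≋ q → ∀ k → powP p k ≋ powP q k
powP-cong e zero    = ≋-refl
powP-cong e (suc k) = *P-cong (powP-cong e k) e

powP-+ : ∀ p m n → powP p (m ℕ.+ n) ≋ powP p m *P powP p n
powP-+ p m zero    = ≋-trans (Poly.reflexive (cong (powP p) (ℕₚ.+-identityʳ m))) (≋-sym (Poly.*-identityʳ (powP p m)))
powP-+ p m (suc n) = ≋-trans (Poly.reflexive (cong (powP p) (ℕₚ.+-suc m n)))
  (≋-trans (*P-congʳ (powP-+ p m n) p) (*P-assoc (powP p m) (powP p n) p))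

powP-oneP : ∀ k → powP oneP k ≋ oneP
powP-oneP zero    = ≋-refl
powP-oneP (suc k) = ≋-trans (*P-congʳ (powP-oneP k) oneP) (*P-identityˡ oneP)

powP-* : ∀ p m n → powP p (m ℕ.* n) ≋ powP (powP p n) m
powP-* p zero    n = ≋-refl
powP-* p (suc m) n = ≋-trans (powP-+ p n (m ℕ.* n))
  (≋-trans (*P-congˡ (powP p n) (powP-* p m n)) (*P-comm (powP p n) (powP (powP p n) m)))

powP-distrib-*P : ∀ p q k → powP (p *P q) k ≋ powP p k *P powP q k
powP-distrib-*P p q zero    = ≋-sym (*P-identityˡ oneP)
powP-distrib-*P p q (suc k) = ≋-trans (*P-congʳ (powP-distrib-*P p q k) (p *P q))
  (solve 4 (λ a b p q → a :* b :* (p :* q) := a :* p :* (b :* q)) ≋-refl (powP p k) (powP q k) p q)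

geo : Poly → ℕ → Poly
geo p zero    = []
geo p (suc k) = geo p k +P powP p k

geo-sum : ∀ p k → geo p k *P (p -P oneP) ≋ powP p k -P oneP
geo-sum p zero    = ≋-sym (+P-inverseʳ oneP)
geo-sum p (suc k) = begin
  (geo p k +P powP p k) *P (p -P oneP)
    ≈⟨ solve 3 (λ g x p → (g :+ x) :* (p :- con 1ℤ) := g :* (p :- con 1ℤ) :+ (x :* p :- x)) ≋-refl (geo p k) (powP p k) p ⟩
  geo p k *P (p -P oneP) +P (powP p k *P p -P powP p k) ≈⟨ +P-cong (geo-sum p k) (≋-refl {powP p k *P p -P powP p k}) ⟩
  (powP p k -P oneP) +P (powP p k *P p -P powP p k)
    ≈⟨ solve 2 (λ x p → (x :- con 1ℤ) :+ (x :* p :- x) := x :* p :- con 1ℤ) ≋-refl (powP p k) p ⟩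
  powP p k *P p -P oneP ∎
  where open ≋-Reasoning

-- Modulo `p -P oneP` each of the `k` powers is 1. The integer `k` obtained here becomes the Bézout
-- constant in `unity-proper-Coprime`.
geo-mod-const : ∀ p k → ∃ λ w → geo p k ≋ [ + k ] +P w *P (p -P oneP)
geo-mod-const p zero    = [] , ≋-sym (∷-≋-[] refl ≋-refl)
geo-mod-const p (suc k) = proj₁ ih +P geo p k , (begin
  geo p k +P powP p k
    ≈⟨ solve 2 (λ g x → g :+ x := con 1ℤ :+ g :+ (x :- con 1ℤ)) ≋-refl (geo p k) (powP p k) ⟩
  oneP +P geo p k +P (powP p k -P oneP)
    ≈⟨ +P-cong (+P-cong (≋-refl {oneP}) (proj₂ ih)) (≋-sym (geo-sum p k)) ⟩
  oneP +P ([ + k ] +P proj₁ ih *P (p -P oneP)) +P geo p k *P (p -P oneP)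
    ≈⟨ solve 4 (λ c w d g → con 1ℤ :+ (c :+ w :* d) :+ g :* d := (con 1ℤ :+ c) :+ (w :+ g) :* d) ≋-refl
         [ + k ] (proj₁ ih) (p -P oneP) (geo p k) ⟩
  [ + suc k ] +P (proj₁ ih +P geo p k) *P (p -P oneP) ∎)
  where
  open ≋-Reasoning
  ih = geo-mod-const p k

-- Substitution for the variable

infixl 8 _∘P_
-- `composeX^ p e` is definitionally `p ∘P X^ e`, so Φₙ(q²) in the modulus is
-- `cyclotomic n ∘P X^ 2`.
_∘P_ : Poly → Poly → Poly
p ∘P y = foldr (λ a acc → [ a ] +P (y *P acc)) [] p

∘P-≋[] : ∀ {p} → p ≋ [] → ∀ y → p ∘P y ≋ []
∘P-≋[] {[]}    e y = ≋-refl
∘P-≋[] {a ∷ p} e y = ≋-trans (+P-cong (∷-≋-[] {p = []} (at e 0) ≋-refl)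
  (≋-trans (*P-congˡ y (∘P-≋[] (≋-tail-[] e) y)) (*P-zeroʳ y))) ≋-refl

∘P-+P : ∀ p q y → (p +P q) ∘P y ≋ p ∘P y +P q ∘P y
∘P-+P []      q       y = ≋-refl
∘P-+P (a ∷ p) []      y = ≋-sym (+P-identityʳ _)
∘P-+P (a ∷ p) (b ∷ q) y = ≋-trans
  (+P-cong (≋-refl {[ a ℤ.+ b ]}) (*P-congˡ y (∘P-+P p q y)))
  (solve 5 (λ a b y s t → (a :+ b) :+ y :* (s :+ t) := (a :+ y :* s) :+ (b :+ y :* t)) ≋-refl
    [ a ] [ b ] y (p ∘P y) (q ∘P y))

∘P-scaleP : ∀ c p y → scaleP c p ∘P y ≋ [ c ] *P (p ∘P y)
∘P-scaleP c []      y = ≋-sym (*P-zeroʳ [ c ])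
∘P-scaleP c (a ∷ p) y = ≋-trans (+P-cong (const-*-homo c a) (*P-congˡ y (∘P-scaleP c p y)))
  (solve 4 (λ c a y s → c :* a :+ y :* (c :* s) := c :* (a :+ y :* s)) ≋-refl [ c ] [ a ] y (p ∘P y))

∘P-*P : ∀ p q y → (p *P q) ∘P y ≋ p ∘P y *P q ∘P y
∘P-*P []      q y = ≋-refl
∘P-*P (a ∷ p) q y = begin
  (scaleP a q +P (0ℤ ∷ (p *P q))) ∘P y          ≈⟨ ∘P-+P (scaleP a q) (0ℤ ∷ (p *P q)) y ⟩
  scaleP a q ∘P y +P ([ 0ℤ ] +P y *P ((p *P q) ∘P y))
    ≈⟨ +P-cong (∘P-scaleP a q y) (+P-cong (≋-refl {[ 0ℤ ]}) (*P-congˡ y (∘P-*P p q y))) ⟩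
  [ a ] *P (q ∘P y) +P ([ 0ℤ ] +P y *P (p ∘P y *P q ∘P y))
    ≈⟨ solve 4 (λ a s y t → a :* s :+ (con 0ℤ :+ y :* (t :* s)) := (a :+ y :* t) :* s) ≋-refl [ a ] (q ∘P y) y (p ∘P y) ⟩
  ([ a ] +P y *P (p ∘P y)) *P (q ∘P y) ∎
  where open ≋-Reasoning

∘P-const : ∀ c y → [ c ] ∘P y ≋ [ c ]
∘P-const c y = ≋-trans (+P-cong (≋-refl {[ c ]}) (*P-zeroʳ y)) (+P-identityʳ [ c ])

∘P-cong : ∀ {p q} → p ≋ q → ∀ y → p ∘P y ≋ q ∘P y
∘P-cong {[]}    {q}     e y = ≋-sym (∘P-≋[] (≋-sym e) y)
∘P-cong {a ∷ p} {[]}    e y = ∘P-≋[] e y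
∘P-cong {a ∷ p} {b ∷ q} e y =
  +P-cong (∷-cong {p = []} (at e 0) ≋-refl) (*P-congˡ y (∘P-cong (≋-tail e) y))

∘P-X^ : ∀ n y → X^ n ∘P y ≋ powP y n
∘P-X^ zero    y = ∘P-const 1ℤ y
∘P-X^ (suc n) y = ≋-trans (+P-cong (∷-≋-[] {p = []} refl ≋-refl) (*P-congˡ y (∘P-X^ n y)))
  (*P-comm y (powP y n))

-- Substitution is a ring homomorphism that fixes constants, so it carries Bézout identities along.
-- This moves coprimality with Φₙ(x) to Φₙ(q²).
Coprime-∘P : ∀ {a p} → Coprime a p → ∀ y → Coprime (a ∘P y) (p ∘P y)
Coprime-∘P {a} {p} (bezout u v m m≢0 eq) y = bezout (u ∘P y) (v ∘P y) m m≢0 (begin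
  u ∘P y *P a ∘P y +P v ∘P y *P p ∘P y ≈⟨ ≋-sym (+P-cong (∘P-*P u a y) (∘P-*P v p y)) ⟩
  (u *P a) ∘P y +P (v *P p) ∘P y       ≈⟨ ≋-sym (∘P-+P (u *P a) (v *P p) y) ⟩
  (u *P a +P v *P p) ∘P y              ≈⟨ ∘P-cong eq y ⟩
  [ m ] ∘P y                           ≈⟨ ∘P-const m y ⟩
  [ m ]                                ∎)
  where open ≋-Reasoning

-- Cyclotomic polynomials

-- cyclotomic (suc n) with ++, reverse, strip, length and strip (xⁿ⁺¹ − 1) replaced by parameters;
-- suitable parameters isolate the private functions in it.
mutual
  shape : (List Poly → List Poly → List Poly) → (Poly → Poly) → (Poly → Poly) → (Poly → ℕ) → Poly → ℕ → Poly
  shape = _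

  cyclotomic-shape : ∀ n → cyclotomic (suc n) ≡ shape _++_ reverse strip length (strip (X^ (suc n) -P oneP)) n
  cyclotomic-shape n with _++_ {A = Poly} | reverse {A = ℤ} | length {A = ℤ} | strip (X^ (suc n) -P oneP)
  ... | app | rev | len | h with strip
  ... | str = refl

lastOf : List Poly → Poly
lastOf zs = shape (λ _ _ → zs) reverse strip length [] 0

mutual
  cyc : ℕ → List Poly
  cyc = _

  -- When `++` is made to return a one-element list, the private last-element function gives back
  -- that element, here `e` of the private list of the first `n` cyclotomic polynomials. As `e` is a
  -- variable, unification can strip it off.
  shape-cyc : (e : List Poly → Poly) → ∀ n → shape (λ xs _ → [ e xs ]) reverse strip length [] n ≡ e (cyc n)
  shape-cyc e n = refl

mutual
  prodDiv : ℕ → ℕ → List Poly → Poly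
  prodDiv = _

  -- Replacing `++` by its second argument and `reverse` by the identity leaves a single bare long
  -- division, whose divisor is the private product under the variable `s`.
  prodDiv-spec : (s : Poly → Poly) (l : Poly → ℕ) (h : Poly) → ∀ n →
    shape (λ _ ys → ys) (λ x → x) s l h n ≡ divHigh (l h) h (s (prodDiv (suc n) 1 (cyc n)))
  prodDiv-spec s l h n with suc n | cyc n
  ... | N | ps with 1
  ... | k = refl

pick : ℕ → ℕ → Poly → Poly
pick N d p with d ∣? N
... | yes _ = p
... | no  _ = oneP

pick-yes : ∀ {N d} p → d ∣ N → pick N d p ≡ p
pick-yes {N} {d} p d∣N with d ∣? N
... | yes _   = refl
... | no  d∤N = contradiction d∣N d∤N

-- The private product consumes its list from the front, while the list of cyclotomic polynomials
-- grows at its end; this reconciles the two directions.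
prodDiv-∷ʳ : ∀ N d ps p → prodDiv N d (ps ++ [ p ]) ≋ pick N (d ℕ.+ length ps) p *P prodDiv N d ps
prodDiv-∷ʳ N d [] p rewrite ℕₚ.+-identityʳ d with d ∣? N
... | yes _ = ≋-refl
... | no  _ = ≋-refl
prodDiv-∷ʳ N d (x ∷ ps) p rewrite ℕₚ.+-suc d (length ps) with d ∣? N
... | no  _ = prodDiv-∷ʳ N (suc d) ps p
... | yes _ = ≋-trans (*P-congˡ x (prodDiv-∷ʳ N (suc d) ps p))
  (solve 3 (λ x y z → x :* (y :* z) := y :* (x :* z)) ≋-refl
    x (pick N (suc d ℕ.+ length ps) p) (prodDiv N (suc d) ps))

lastOf-∷ʳ : ∀ ps p → lastOf (ps ++ [ p ]) ≡ p
lastOf-∷ʳ []           p = refl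
lastOf-∷ʳ (x ∷ [])     p = refl
lastOf-∷ʳ (x ∷ y ∷ ps) p = lastOf-∷ʳ (y ∷ ps) p

-- The polynomials xⁿ - 1 and the product formula for Φₙ

unity : ℕ → Poly
unity n = X^ n -P oneP

cyclotomic-suc : ∀ n → cyclotomic (suc n) ≡ divMonic (unity (suc n)) (prodDiv (suc n) 1 (cyc n))
cyclotomic-suc n = lastOf-∷ʳ (cyc n) _

length-cyc : ∀ n → length (cyc n) ≡ n
length-cyc zero    = refl
length-cyc (suc n) = trans (Listₚ.length-++ (cyc n)) (trans (ℕₚ.+-comm (length (cyc n)) 1) (cong suc (length-cyc n)))

-- The bound `m` is separate from `N` so that one function covers the full product (`m = N`), the
-- product over proper divisors, and the partial products of the induction.
prodΦ : ℕ → ℕ → Poly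
prodΦ N zero    = oneP
prodΦ N (suc m) = pick N (suc m) (cyclotomic (suc m)) *P prodΦ N m

prodDiv-cyc : ∀ N m → prodDiv N 1 (cyc m) ≋ prodΦ N m
prodDiv-cyc N zero    = ≋-refl
prodDiv-cyc N (suc m) = ≋-trans (prodDiv-∷ʳ N 1 (cyc m) _)
  (*P-cong (Poly.reflexive (cong₂ (pick N) (cong suc (length-cyc m)) (sym (cyclotomic-suc m)))) (prodDiv-cyc N m))

X^-* : ∀ m n → X^ (m ℕ.* n) ≋ powP (X^ n) m
X^-* zero    n = ≋-refl
X^-* (suc m) n = ≋-trans (X^-+ n (m ℕ.* n))
  (≋-trans (*P-congˡ (X^ n) (X^-* m n)) (*P-comm (X^ n) (powP (X^ n) m)))

unity-* : ∀ k g → unity (k ℕ.* g) ≋ geo (X^ g) k *P unity g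
unity-* k g = ≋-trans (+P-cong (X^-* k g) (≋-refl {negP oneP})) (≋-sym (geo-sum (X^ g) k))

Monic-X^ : ∀ n → Monic n (X^ n)
Monic-X^ zero    = monic refl λ { (suc i) _ → refl }
Monic-X^ (suc n) = monic (Monic.leading-coeff (Monic-X^ n))
  λ { (suc i) (s≤s l) → Monic.degree-bound (Monic-X^ n) i l }

Monic-cong : ∀ {d p q} → p ≋ q → Monic d p → Monic d q
Monic-cong {d} e (monic p₁ b) = monic (trans (sym (at e d)) p₁) (Below-cong e b)

Monic-unity : ∀ n → Monic (suc n) (unity (suc n))
Monic-unity n = monic (trans (at (+P-identityʳ (X^ n)) n) (Monic.leading-coeff (Monic-X^ n)))
  λ { (suc i) (s≤s l) → trans (at (+P-identityʳ (X^ n)) i) (Monic.degree-bound (Monic-X^ n) i l) }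

unity≉[] : ∀ {n} → 0 < n → ¬ (unity n ≋ [])
unity≉[] {suc n} _ = Monic-≉[] (Monic-unity n)

Monic-cofactor : ∀ {N d f p g} → Monic N f → Monic d g → f ≋ p *P g → ∃ λ e → Monic e p
Monic-cofactor {N} {d} {f} {p} {g} (monic f₁ bf) (monic g₁ bg) eq with leading p
... | inj₁ p≋0 = contradiction (≋-trans eq (*P-zeroˡ p≋0 g)) (Monic-≉[] (monic f₁ bf))
... | inj₂ (e , p≢0 , bp) = e , monic p₁ bp
  where
  f-top : coeff f (e ℕ.+ d) ≡ coeff p e
  f-top = trans (at eq (e ℕ.+ d)) (trans (coeff-*P-top p g e d bp bg)
    (trans (cong (coeff p e ℤ.*_) g₁) (ℤₚ.*-identityʳ _)))
  p₁ : coeff p e ≡ 1ℤ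
  p₁ with ℕₚ.<-cmp N (e ℕ.+ d)
  ... | tri≈ _ refl _ = trans (sym f-top) f₁
  ... | tri< lt _ _ = contradiction (trans (sym f-top) (bf (e ℕ.+ d) lt)) p≢0
  ... | tri> _ _ gt = contradiction
          (trans (sym f₁) (trans (at eq N) (Below-*P p g e d bp bg N gt))) λ ()

-- The induction invariant: `product` says that the long division defining Φₙ was exact, and
-- `isMonic` makes Φₙ admissible in later divisors.
record Cyclotomic (n : ℕ) : Set where
  field
    degree  : ℕ
    isMonic : Monic degree (cyclotomic n)
    product : prodΦ n n ≋ unity n

pick-∣ : ∀ {g n} d p → (d ∣ g → d ∣ n) → ∃ λ h → pick n d p ≋ h *P pick g d p
pick-∣ {g} {n} d p d∣ with d ∣? n | d ∣? g
... | yes _   | yes _   = oneP , ≋-sym (*P-identityˡ p)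
... | no  _   | no  _   = oneP , ≋-sym (*P-identityˡ oneP)
... | yes _   | no  _   = p , ≋-sym (Poly.*-identityʳ p)
... | no  d∤n | yes d∣g = contradiction (d∣ d∣g) d∤n

prodΦ-∣ : ∀ {g n} m → g ∣ n → ∃ λ h → prodΦ n m ≋ h *P prodΦ g m
prodΦ-∣ {g} {n} zero    g∣n = oneP , ≋-sym (*P-identityˡ oneP)
prodΦ-∣ {g} {n} (suc m) g∣n = h *P h′ ,
  ≋-trans (*P-cong eq eq′)
    (solve 4 (λ a b c d → a :* b :* (c :* d) := a :* c :* (b :* d)) ≋-refl
      h (pick g (suc m) (cyclotomic (suc m))) h′ (prodΦ g m))
  where
  this = pick-∣ {g} {n} (suc m) (cyclotomic (suc m)) (λ d∣g → ℕ∣.∣-trans d∣g g∣n)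
  rest = prodΦ-∣ {g} {n} m g∣n
  h    = proj₁ this
  eq   = proj₂ this
  h′   = proj₁ rest
  eq′  = proj₂ rest

prodΦ-extend : ∀ n m j → ∃ λ h → prodΦ n (j ℕ.+ m) ≋ h *P prodΦ n m
prodΦ-extend n m zero    = oneP , ≋-sym (*P-identityˡ (prodΦ n m))
prodΦ-extend n m (suc j) = c *P proj₁ ih , ≋-trans (*P-congˡ c (proj₂ ih)) (≋-sym (*P-assoc c (proj₁ ih) (prodΦ n m)))
  where
  ih = prodΦ-extend n m j
  c  = pick n (suc (j ℕ.+ m)) (cyclotomic (suc (j ℕ.+ m)))

cyclotomic-product : ∀ {n} → Cyclotomic (suc n) → cyclotomic (suc n) *P prodΦ (suc n) n ≋ unity (suc n)
cyclotomic-product {n} c = ≋-trans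
  (*P-congʳ (Poly.reflexive (sym (pick-yes (cyclotomic (suc n)) (ℕ∣.∣-refl {suc n})))) (prodΦ (suc n) n))
  (Cyclotomic.product c)

-- For a proper divisor g of n, Φₙ divides (xⁿ − 1)/(xᵍ − 1), which is n/g modulo xᵍ − 1.
unity-proper-Coprime : ∀ {n g} → Cyclotomic (suc n) → Cyclotomic g → 0 < g → g ≤ n → g ∣ suc n →
                       Coprime (unity g) (cyclotomic (suc n))
unity-proper-Coprime {n} {g} cₙ c_g 0<g g≤n (divides k n≡kg) =
  bezout (negP w) h (+ k) k≢0 (begin
    negP w *P unity g +P h *P Φ        ≈⟨ +P-cong (≋-refl {negP w *P unity g}) (≋-trans (*P-comm h Φ) Φ*h) ⟩
    negP w *P unity g +P geo (X^ g) k  ≈⟨ +P-cong (≋-refl {negP w *P unity g}) (proj₂ gm) ⟩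
    negP w *P unity g +P ([ + k ] +P w *P unity g)
      ≈⟨ solve 3 (λ w u c → (:- w) :* u :+ (c :+ w :* u) := c) ≋-refl w (unity g) [ + k ] ⟩
    [ + k ] ∎)
  where
  open ≋-Reasoning
  Φ = cyclotomic (suc n)
  gm = geo-mod-const (X^ g) k
  w = proj₁ gm
  ext = prodΦ-extend (suc n) g (n ∸ g)
  sub-∣ = prodΦ-∣ {g} {suc n} g (divides k n≡kg)
  h = proj₁ ext *P proj₁ sub-∣
  k≢0 : + k ≢ 0ℤ
  k≢0 refl = contradiction n≡kg λ ()
  prodΦ-split : prodΦ (suc n) n ≋ h *P unity g
  prodΦ-split = begin
    prodΦ (suc n) n               ≡⟨ cong (prodΦ (suc n)) (sym (ℕₚ.m∸n+n≡m g≤n)) ⟩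
    prodΦ (suc n) (n ∸ g ℕ.+ g)   ≈⟨ proj₂ ext ⟩
    proj₁ ext *P prodΦ (suc n) g  ≈⟨ *P-congˡ (proj₁ ext) (≋-trans (proj₂ sub-∣) (*P-congˡ (proj₁ sub-∣) (Cyclotomic.product c_g))) ⟩
    proj₁ ext *P (proj₁ sub-∣ *P unity g) ≈⟨ ≋-sym (*P-assoc (proj₁ ext) (proj₁ sub-∣) (unity g)) ⟩
    h *P unity g                  ∎
  Φ*h : Φ *P h ≋ geo (X^ g) k
  Φ*h = *P-cancelʳ (unity g) (unity≉[] 0<g) (begin
    Φ *P h *P unity g     ≈⟨ *P-assoc Φ h (unity g) ⟩
    Φ *P (h *P unity g)   ≈⟨ *P-congˡ Φ (≋-sym prodΦ-split) ⟩
    Φ *P prodΦ (suc n) n  ≈⟨ cyclotomic-product cₙ ⟩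
    unity (suc n)         ≡⟨ cong unity n≡kg ⟩
    unity (k ℕ.* g)       ≈⟨ unity-* k g ⟩
    geo (X^ g) k *P unity g ∎)

cyclotomic-∣-unity : ∀ {n} → Cyclotomic (suc n) → cyclotomic (suc n) ∣ˢ unity (suc n)
cyclotomic-∣-unity {n} c = ∣ˢ-factor (prodΦ (suc n) n) (≋-trans (≋-sym (cyclotomic-product c))
  (*P-comm (cyclotomic (suc n)) (prodΦ (suc n) n)))

-- As `p` divides xⁿ - 1, exponents count modulo n. If g + yn = xj, then x^{xj} - 1 ≡ x^g - 1. If g
-- + xj = yn, then x^g x^{xj} ≡ 1, so x^g - 1 ≡ -x^g (x^{xj} - 1). In both cases xʲ - 1 divides the
-- representative.
unity-gcd : ∀ {g j n} p → p ∣ˢ unity n → Bézout.Identity g j n → ∃ λ a → p ∣ˢ (a *P unity j -P unity g)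
unity-gcd {g} {j} {n} p p∣ (Bézout.+- x y eq) = geo (X^ j) x , divisible (begin
  geo (X^ j) x *P unity j       ≈⟨ ≋⇒Mod (≋-sym (unity-* x j)) ⟩
  unity (x ℕ.* j)               ≡⟨ cong unity (sym eq) ⟩
  unity (g ℕ.+ y ℕ.* n)         ≈⟨ ≋⇒Mod (+P-cong (≋-trans (X^-+ g (y ℕ.* n)) (*P-congˡ (X^ g) (X^-* y n))) (≋-refl {negP oneP})) ⟩
  X^ g *P powP (X^ n) y -P oneP ≈⟨ Mod-+P (Mod-*P (≋⇒Mod (≋-refl {X^ g})) (Mod-trans (Mod-powP (congruent p∣) y) (≋⇒Mod (powP-oneP y))))
                                     (≋⇒Mod (≋-refl {negP oneP})) ⟩
  X^ g *P oneP -P oneP          ≈⟨ ≋⇒Mod (+P-cong (Poly.*-identityʳ (X^ g)) (≋-refl {negP oneP})) ⟩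
  unity g                       ∎)
  where open Mod-Reasoning p
unity-gcd {g} {j} {n} p p∣ (Bézout.-+ x y eq) = negP (X^ g) *P geo (X^ j) x , divisible (begin
  negP (X^ g) *P geo (X^ j) x *P unity j  ≈⟨ ≋⇒Mod (≋-trans (*P-assoc (negP (X^ g)) (geo (X^ j) x) (unity j))
                                               (*P-congˡ (negP (X^ g)) (≋-sym (unity-* x j)))) ⟩
  negP (X^ g) *P (X^ (x ℕ.* j) -P oneP)   ≈⟨ ≋⇒Mod (solve 2 (λ a b → (:- a) :* (b :- con 1ℤ) := a :- a :* b) ≋-refl (X^ g) (X^ (x ℕ.* j))) ⟩
  X^ g -P X^ g *P X^ (x ℕ.* j)            ≈⟨ ≋⇒Mod (+P-cong (≋-refl {X^ g}) (negP-cong (≋-trans (≋-sym (X^-+ g (x ℕ.* j)))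
                                               (≋-trans (Poly.reflexive (cong X^ eq)) (X^-* y n))))) ⟩
  X^ g -P powP (X^ n) y                   ≈⟨ Mod-+P (≋⇒Mod (≋-refl {X^ g})) (Mod-negP (Mod-trans (Mod-powP (congruent p∣) y) (≋⇒Mod (powP-oneP y)))) ⟩
  unity g                                 ∎)
  where open Mod-Reasoning p

-- The gcd of `j` and `suc n` is a proper divisor of `suc n`. Modulo Φ a multiple of xʲ - 1 equals
-- x^gcd - 1, for which `unity-proper-Coprime` applies. The cyclotomic facts are a bounded
-- hypothesis so that the lemma can be used inside the induction that establishes them.
unity-Coprime : ∀ {n} → (∀ {k} → k < suc n → Cyclotomic (suc k)) →
                ∀ {j} → ¬ (suc n ∣ j) → Coprime (unity j) (cyclotomic (suc n))
unity-Coprime {n} cyc-upto {j} n∤j with Bézout.lemma j (suc n)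
... | Bézout.result zero gcd _ = contradiction (ℕ∣.0∣⇒≡0 (proj₂ (GCD.commonDivisor gcd))) λ ()
... | Bézout.result (suc g) gcd id =
  Coprime-factor (proj₁ a) (Coprime-resp-∣ˢ (proj₂ a)
    (unity-proper-Coprime (cyc-upto ℕₚ.≤-refl) (cyc-upto (ℕₚ.<-trans (ℕₚ.n<1+n g) (s≤s g≤n))) (s≤s z≤n) g≤n g∣n))
  where
  g∣j = proj₁ (GCD.commonDivisor gcd)
  g∣n = proj₂ (GCD.commonDivisor gcd)
  g≤n : suc g ≤ n
  g≤n = ℕ.s≤s⁻¹ (ℕₚ.≤∧≢⇒< (ℕ∣.∣⇒≤ g∣n) λ { refl → n∤j g∣j })
  a = unity-gcd (cyclotomic (suc n)) (cyclotomic-∣-unity (cyc-upto ℕₚ.≤-refl)) id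

pick-Coprime : ∀ {N d p q} → Coprime p q → Coprime (pick N d p) q
pick-Coprime {N} {d} {p} {q} c with d ∣? N
... | yes _ = c
... | no  _ = Coprime-const q λ ()

-- Strong induction. For l < m, Φ_l divides xˡ - 1, which is prime to Φ_m; so the Φ_d of lower index
-- are pairwise coprime, and the product of those with d dividing `suc n` divides x^{n+1} - 1 over
-- ℚ. That product is monic, so `divMonic-exact` makes the division exact over ℤ.
cyclotomic-isCyclotomic-upto : ∀ n {k} → k < n → Cyclotomic (suc k)
cyclotomic-isCyclotomic-upto (suc n) {k} (s≤s k≤n) with ℕₚ.m≤n⇒m<n∨m≡n k≤n
... | inj₁ k<n  = cyclotomic-isCyclotomic-upto n k<n
... | inj₂ refl = record
  { degree = proj₁ Φ-monic
  ; isMonic = proj₂ Φ-monic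
  ; product = ≋-trans (*P-congʳ (Poly.reflexive (pick-yes Φ (ℕ∣.∣-refl {suc n}))) (prodΦ (suc n) n)) (≋-sym Φ-product) }
  where
  open ≋-Reasoning
  IH : ∀ {k} → k < n → Cyclotomic (suc k)
  IH = cyclotomic-isCyclotomic-upto n
  Φ = cyclotomic (suc n)

  prodΦ-Coprime : ∀ {m} → m < n → ∀ l → l ≤ m → Coprime (prodΦ (suc n) l) (cyclotomic (suc m))
  prodΦ-Coprime {m} m<n zero    _   = Coprime-const _ λ ()
  prodΦ-Coprime {m} m<n (suc l) l<m = Coprime-*P (pick-Coprime {suc n} {suc l} Φ-Coprime)
    (prodΦ-Coprime m<n l (ℕₚ.<⇒≤ l<m))
    where
    unity-l : Coprime (unity (suc l)) (cyclotomic (suc m))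
    unity-l = unity-Coprime (λ k≤m → IH (ℕₚ.≤-trans k≤m m<n)) (ℕ∣.>⇒∤ (s≤s l<m))
    Φ-Coprime : Coprime (cyclotomic (suc l)) (cyclotomic (suc m))
    Φ-Coprime = Coprime-factor (prodΦ (suc l) l) (Coprime-cong
      (≋-trans (≋-sym (cyclotomic-product (IH (ℕₚ.<-trans l<m m<n)))) (*P-comm _ (prodΦ (suc l) l))) unity-l)

  partial : ∀ m → m ≤ n → (∃ λ d → Monic d (prodΦ (suc n) m)) × prodΦ (suc n) m ∣ˢ unity (suc n)
  partial zero    _   = (0 , Monic-X^ 0) , ∣ˢ-factor (unity (suc n)) (≋-sym (Poly.*-identityʳ (unity (suc n))))
  partial (suc m) m<n with suc m ∣? suc n
  ... | no _ = (proj₁ (proj₁ ih) , Monic-cong (≋-sym (*P-identityˡ _)) (proj₂ (proj₁ ih)))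
             , ∣ˢ-congˡ (≋-sym (*P-identityˡ _)) (proj₂ ih)
    where ih = partial m (ℕₚ.<⇒≤ m<n)
  ... | yes (divides k n≡k*m) =
      (_ , Monic-*P (Cyclotomic.isMonic (IH m<n)) (proj₂ (proj₁ ih)))
    , Coprime-∣ˢ-*P (Coprime-sym (prodΦ-Coprime m<n m ℕₚ.≤-refl))
        (∣ˢ-cong (≋-trans (≋-sym (unity-* k (suc m))) (Poly.reflexive (cong unity (sym n≡k*m))))
          (∣ˢ-*P (geo (X^ (suc m)) k) (cyclotomic-∣-unity (IH m<n))))
        (proj₂ ih)
    where ih = partial m (ℕₚ.<⇒≤ m<n)

  all-proper = partial n ℕₚ.≤-refl
  g = prodDiv (suc n) 1 (cyc n)
  g-monic : Monic (proj₁ (proj₁ all-proper)) g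
  g-monic = Monic-cong (≋-sym (prodDiv-cyc (suc n) n)) (proj₂ (proj₁ all-proper))
  g∣ : g ∣ˢ unity (suc n)
  g∣ = ∣ˢ-congˡ (≋-sym (prodDiv-cyc (suc n) n)) (proj₂ all-proper)
  Φ-product′ : unity (suc n) ≋ Φ *P g
  Φ-product′ = ≋-trans (divMonic-exact (unity (suc n)) g (_∣ˢ_.quotient g∣) g-monic (_∣ˢ_.scalar≢0 g∣) (_∣ˢ_.equality g∣))
    (*P-congʳ (Poly.reflexive (sym (cyclotomic-suc n))) g)
  Φ-product : unity (suc n) ≋ Φ *P prodΦ (suc n) n
  Φ-product = ≋-trans Φ-product′ (*P-congˡ Φ (prodDiv-cyc (suc n) n))
  Φ-monic : ∃ λ e → Monic e Φ
  Φ-monic = Monic-cofactor (Monic-unity n) g-monic Φ-product′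

cyclotomic-isCyclotomic : ∀ n → Cyclotomic (suc n)
cyclotomic-isCyclotomic n = cyclotomic-isCyclotomic-upto (suc n) ℕₚ.≤-refl

-- q-factorials

-- `Q` is a parameter, so its powers do not unfold to coefficient lists. The second hypothesis is
-- what all cancellations in this module rest on.
module QProducts (Q : Poly) (Q^≉1 : ∀ k → ¬ (oneP -P powP Q (suc k) ≋ [])) where

  ω : ℕ → Poly
  ω k = oneP -P powP Q k

  ω-cong : ∀ {j k} → j ≡ k → ω j ≋ ω k
  ω-cong refl = ≋-refl

  -- (Q;Q)_N, (Q;Q²)_N, (Q²;Q²)_N and (−Q;Q)_N.
  fact oddFact evenFact plusFact : ℕ → Poly
  fact zero        = oneP
  fact (suc N)     = fact N *P ω (suc N)
  oddFact zero     = oneP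
  oddFact (suc N)  = oddFact N *P ω (suc (N ℕ.+ N))
  evenFact zero    = oneP
  evenFact (suc N) = evenFact N *P ω (suc N ℕ.+ suc N)
  plusFact zero    = oneP
  plusFact (suc N) = plusFact N *P (oneP +P powP Q (suc N))

  fact≉[] : ∀ N → ¬ (fact N ≋ [])
  fact≉[] zero    = const≉[] λ ()
  fact≉[] (suc N) = *P-≉[] (fact≉[] N) (Q^≉1 N)

  evenFact≉[] : ∀ N → ¬ (evenFact N ≋ [])
  evenFact≉[] zero    = const≉[] λ ()
  evenFact≉[] (suc N) = *P-≉[] (evenFact≉[] N) (Q^≉1 (N ℕ.+ suc N))

  -- q-binomial coefficients and their cofactors

  oddFact-evenFact : ∀ N → oddFact N *P evenFact N ≋ fact (N ℕ.+ N)
  oddFact-evenFact zero    = *P-identityˡ oneP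
  oddFact-evenFact (suc N) = begin
    oddFact N *P ω (suc (N ℕ.+ N)) *P (evenFact N *P ω (suc N ℕ.+ suc N))
      ≈⟨ solve 4 (λ a b c d → a :* b :* (c :* d) := a :* c :* b :* d) ≋-refl
           (oddFact N) (ω (suc (N ℕ.+ N))) (evenFact N) (ω (suc N ℕ.+ suc N)) ⟩
    oddFact N *P evenFact N *P ω (suc (N ℕ.+ N)) *P ω (suc N ℕ.+ suc N)
      ≈⟨ *P-congʳ (*P-congʳ (oddFact-evenFact N) (ω (suc (N ℕ.+ N)))) (ω (suc N ℕ.+ suc N)) ⟩
    fact (suc (N ℕ.+ N)) *P ω (suc N ℕ.+ suc N)
      ≡⟨ cong (λ k → fact k *P ω (suc N ℕ.+ suc N)) (sym (ℕₚ.+-suc N N)) ⟩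
    fact (suc N ℕ.+ suc N) ∎
    where open ≋-Reasoning

  ω-double : ∀ k → ω (k ℕ.+ k) ≋ ω k *P (oneP +P powP Q k)
  ω-double k = ≋-trans (+P-cong (≋-refl {oneP}) (negP-cong (powP-+ Q k k)))
    (solve 1 (λ x → con 1ℤ :- x :* x := (con 1ℤ :- x) :* (con 1ℤ :+ x)) ≋-refl (powP Q k))

  evenFact-split : ∀ N → evenFact N ≋ fact N *P plusFact N
  evenFact-split zero    = ≋-sym (*P-identityˡ oneP)
  evenFact-split (suc N) = ≋-trans (*P-cong (evenFact-split N) (ω-double (suc N)))
    (solve 4 (λ a b c d → a :* b :* (c :* d) := a :* c :* (b :* d)) ≋-refl
      (fact N) (plusFact N) (ω (suc N)) (oneP +P powP Q (suc N)))

  -- gauss a b is the q-binomial coefficient [a+b choose a]_Q.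
  gauss : ℕ → ℕ → Poly
  gauss zero    b       = oneP
  gauss (suc a) zero    = oneP
  gauss (suc a) (suc b) = gauss a (suc b) +P powP Q (suc a) *P gauss (suc a) b

  -- The Pascal recurrence makes `gauss` a polynomial by construction; this ties it to the quotient
  -- of q-factorials.
  gauss-fact : ∀ a b → gauss a b *P (fact a *P fact b) ≋ fact (a ℕ.+ b)
  gauss-fact zero    b       = ≋-trans (*P-identityˡ (oneP *P fact b)) (*P-identityˡ (fact b))
  gauss-fact (suc a) zero    = ≋-trans (*P-identityˡ (fact (suc a) *P oneP))
    (≋-trans (Poly.*-identityʳ (fact (suc a))) (Poly.reflexive (cong fact (sym (ℕₚ.+-identityʳ (suc a))))))
  gauss-fact (suc a) (suc b) = begin
    (g₁ +P x *P g₂) *P (fact a *P ω (suc a) *P (fact b *P ω (suc b)))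
      ≈⟨ solve 7 (λ g₁ x g₂ a a₁ b b₁ → (g₁ :+ x :* g₂) :* (a :* a₁ :* (b :* b₁))
                    := g₁ :* (a :* (b :* b₁)) :* a₁ :+ x :* (g₂ :* (a :* a₁ :* b)) :* b₁) ≋-refl
           g₁ x g₂ (fact a) (ω (suc a)) (fact b) (ω (suc b)) ⟩
    g₁ *P (fact a *P fact (suc b)) *P ω (suc a) +P x *P (g₂ *P (fact (suc a) *P fact b)) *P ω (suc b)
      ≈⟨ +P-cong (*P-congʳ (gauss-fact a (suc b)) (ω (suc a)))
           (*P-congʳ (*P-congˡ x (≋-trans (gauss-fact (suc a) b) (Poly.reflexive (cong fact (sym (ℕₚ.+-suc a b)))))) (ω (suc b))) ⟩
    f *P ω (suc a) +P x *P f *P ω (suc b)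
      ≈⟨ solve 3 (λ f x y → f :* (con 1ℤ :- x) :+ x :* f :* (con 1ℤ :- y) := f :* (con 1ℤ :- x :* y)) ≋-refl f x y ⟩
    f *P (oneP -P x *P y)
      ≈⟨ *P-congˡ f (+P-cong (≋-refl {oneP}) (negP-cong (≋-sym (powP-+ Q (suc a) (suc b))))) ⟩
    f *P ω (suc a ℕ.+ suc b) ∎
    where
    open ≋-Reasoning
    g₁ = gauss a (suc b)
    g₂ = gauss (suc a) b
    x = powP Q (suc a)
    y = powP Q (suc b)
    f = fact (a ℕ.+ suc b)

  -- After multiplication by (Q²;Q²)_N the left side contains (Q;Q)_{2N}, and (Q²;Q²)_N = (Q;Q)_N
  -- (-Q;Q)_N turns both sides into the same product.
  oddFact-gauss : ∀ N → oddFact N *P (plusFact N *P plusFact N) ≋ gauss N N *P evenFact N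
  oddFact-gauss N = *P-cancelʳ (evenFact N) (evenFact≉[] N) (begin
    o *P (π *P π) *P e              ≈⟨ solve 3 (λ o π e → o :* (π :* π) :* e := o :* e :* (π :* π)) ≋-refl o π e ⟩
    o *P e *P (π *P π)              ≈⟨ *P-congʳ (≋-trans (oddFact-evenFact N) (≋-sym (gauss-fact N N))) (π *P π) ⟩
    g *P (fact N *P fact N) *P (π *P π)
      ≈⟨ solve 3 (λ g f π → g :* (f :* f) :* (π :* π) := g :* (f :* π) :* (f :* π)) ≋-refl g (fact N) π ⟩
    g *P (fact N *P π) *P (fact N *P π)
      ≈⟨ *P-cong (*P-congˡ g (≋-sym (evenFact-split N))) (≋-sym (evenFact-split N)) ⟩
    g *P e *P e ∎)
    where
    open ≋-Reasoning
    o = oddFact N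
    e = evenFact N
    π = plusFact N
    g = gauss N N

  -- The q-Catalan number [2N choose N] − Q [2N choose N−1], for N = suc M.
  catalan : ℕ → Poly
  catalan M = gauss (suc M) (suc M) -P Q *P gauss M (suc (suc M))

  -- With N = M + 1, write 1 - Q = (1 - Q^{N+1}) - Q(1 - Q^N); `ratio` then converts [2N choose N](1
  -- - Q^N) into [2N choose N-1](1 - Q^{N+1}). For N = n - 1 the common factor is 1 - Qⁿ.
  gauss-catalan : ∀ M → gauss (suc M) (suc M) *P ω 1 ≋ ω (suc (suc M)) *P catalan M
  gauss-catalan M = begin
    g₀ *P ω 1
      ≈⟨ solve 3 (λ g x q → g :* (con 1ℤ :- con 1ℤ :* q)
                    := g :* (con 1ℤ :- x :* q) :- q :* (g :* (con 1ℤ :- x))) ≋-refl g₀ (powP Q N) Q ⟩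
    g₀ *P ω (suc N) -P Q *P (g₀ *P ω N)
      ≈⟨ +P-cong (≋-refl {g₀ *P ω (suc N)}) (negP-cong (*P-congˡ Q (≋-sym ratio))) ⟩
    g₀ *P ω (suc N) -P Q *P (g₁ *P ω (suc N))
      ≈⟨ solve 4 (λ g₀ g₁ w q → g₀ :* w :- q :* (g₁ :* w) := w :* (g₀ :- q :* g₁)) ≋-refl g₀ g₁ (ω (suc N)) Q ⟩
    ω (suc N) *P (g₀ -P Q *P g₁) ∎
    where
    open ≋-Reasoning
    N = suc M
    g₀ = gauss N N
    g₁ = gauss M (suc N)
    ratio : g₁ *P ω (suc N) ≋ g₀ *P ω N
    ratio = *P-cancelʳ (fact M *P fact N) (*P-≉[] (fact≉[] M) (fact≉[] N)) (begin
      g₁ *P ω (suc N) *P (fact M *P fact N)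
        ≈⟨ solve 4 (λ g w a b → g :* w :* (a :* b) := g :* (a :* (b :* w))) ≋-refl g₁ (ω (suc N)) (fact M) (fact N) ⟩
      g₁ *P (fact M *P fact (suc N))  ≈⟨ gauss-fact M (suc N) ⟩
      fact (M ℕ.+ suc N)              ≡⟨ cong fact (ℕₚ.+-suc M N) ⟩
      fact (N ℕ.+ N)                  ≈⟨ ≋-sym (gauss-fact N N) ⟩
      g₀ *P (fact M *P ω N *P fact N)
        ≈⟨ solve 4 (λ g w a b → g :* (a :* w :* b) := g :* w :* (a :* b)) ≋-refl g₀ (ω N) (fact M) (fact N) ⟩
      g₀ *P ω N *P (fact M *P fact N) ∎)

  -- The quotient of [2h+2 choose h+1]_Q by [2h+1]_Q, written without division.
  halfCatalan : ℕ → Poly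
  halfCatalan h = gauss h h *P ((oneP +P powP Q (suc h)) *P (oneP +P powP Q (suc h))) -P Q *P gauss (suc h) (suc h)

  -- With n = 2h + 1, write 1 - Q = (1 - Q^{n+1}) - Q(1 - Qⁿ). The first part acquires the factor 1
  -- - Qⁿ through `ratio`, which compares the central coefficients for h + 1 and h, because 1 -
  -- Q^{n+1} contains 1 - Q^{h+1}.
  gauss-halfCatalan : ∀ h → gauss (suc h) (suc h) *P ω 1 ≋ ω (suc (h ℕ.+ h)) *P halfCatalan h
  gauss-halfCatalan h = begin
    u *P ω 1
      ≈⟨ solve 3 (λ u q y → u :* (con 1ℤ :- con 1ℤ :* q)
                    := u :* (con 1ℤ :- y :* q) :- q :* (u :* (con 1ℤ :- y))) ≋-refl u Q (powP Q n) ⟩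
    u *P ω (suc n) -P Q *P (u *P ω n)
      ≈⟨ +P-cong (*P-congˡ u (≋-trans (ω-cong (cong suc (sym (ℕₚ.+-suc h h)))) (ω-double N))) (≋-refl {negP (Q *P (u *P ω n))}) ⟩
    u *P (ω N *P s) -P Q *P (u *P ω n)
      ≈⟨ +P-cong (≋-trans (≋-sym (*P-assoc u (ω N) s)) (*P-congʳ ratio s)) (≋-refl {negP (Q *P (u *P ω n))}) ⟩
    v *P ω n *P s *P s -P Q *P (u *P ω n)
      ≈⟨ solve 5 (λ u v w s q → v :* w :* s :* s :- q :* (u :* w) := w :* (v :* (s :* s) :- q :* u)) ≋-refl u v (ω n) s Q ⟩
    ω n *P (v *P (s *P s) -P Q *P u) ∎
    where
    open ≋-Reasoning
    N = suc h
    n = suc (h ℕ.+ h)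
    u = gauss N N
    v = gauss h h
    s = oneP +P powP Q N
    f = fact h
    ratio : u *P ω N ≋ v *P ω n *P s
    ratio = *P-cancelʳ (f *P f *P ω N) (*P-≉[] (*P-≉[] (fact≉[] h) (fact≉[] h)) (Q^≉1 h)) (begin
      u *P ω N *P (f *P f *P ω N)
        ≈⟨ solve 3 (λ u w f → u :* w :* (f :* f :* w) := u :* (f :* w :* (f :* w))) ≋-refl u (ω N) f ⟩
      u *P (fact N *P fact N)                ≈⟨ gauss-fact N N ⟩
      fact (h ℕ.+ suc h) *P ω (N ℕ.+ N)      ≡⟨ cong (λ k → fact k *P ω (N ℕ.+ N)) (ℕₚ.+-suc h h) ⟩
      fact (h ℕ.+ h) *P ω n *P ω (N ℕ.+ N)
        ≈⟨ *P-cong (*P-congʳ (≋-sym (gauss-fact h h)) (ω n)) (ω-double N) ⟩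
      v *P (f *P f) *P ω n *P (ω N *P s)
        ≈⟨ solve 5 (λ v f w x s → v :* (f :* f) :* w :* (x :* s) := v :* w :* s :* (f :* f :* x)) ≋-refl v f (ω n) (ω N) s ⟩
      v *P ω n *P s *P (f *P f *P ω N) ∎)

  ω≋geo : ∀ n → ω n ≋ geo Q n *P ω 1
  ω≋geo n = begin
    oneP -P powP Q n           ≈⟨ solve 1 (λ x → con 1ℤ :- x := :- (x :- con 1ℤ)) ≋-refl (powP Q n) ⟩
    negP (powP Q n -P oneP)    ≈⟨ negP-cong (≋-sym (geo-sum Q n)) ⟩
    negP (geo Q n *P (Q -P oneP))
      ≈⟨ solve 2 (λ g q → :- (g :* (q :- con 1ℤ)) := g :* (con 1ℤ :- con 1ℤ :* q)) ≋-refl (geo Q n) Q ⟩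
    geo Q n *P ω 1             ∎
    where open ≋-Reasoning

  oddFact-geo : ∀ N n c → gauss N N *P ω 1 ≋ ω n *P c →
    oddFact N *P (plusFact N *P plusFact N) ≋ geo Q n *P c *P evenFact N
  oddFact-geo N n c eq = ≋-trans (oddFact-gauss N) (*P-congʳ (*P-cancelʳ {gauss N N} {geo Q n *P c} (ω 1) (Q^≉1 0) (begin
    gauss N N *P ω 1     ≈⟨ eq ⟩
    ω n *P c             ≈⟨ *P-congʳ (ω≋geo n) c ⟩
    geo Q n *P ω 1 *P c  ≈⟨ solve 3 (λ g w c → g :* w :* c := g :* c :* w) ≋-refl (geo Q n) (ω 1) c ⟩
    geo Q n *P c *P ω 1  ∎)) (evenFact N))
    where open ≋-Reasoning

  -- The telescoped bracket and residues modulo Φₙ(Q)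

  weight : Poly → ℕ → Poly
  weight q N = [ + 2 ] *P q *P geo Q (N ℕ.+ N) *P geo Q (suc (N ℕ.+ N)) -P powP Q (N ℕ.+ N)

  -- This is q⁴(2q + 2q⁻¹ - 1): the constant of the theorem, freed of the q⁻⁴ in front of the
  -- telescoped sum.
  target : Poly → Poly
  target q = q *P q *P q *P ([ + 2 ] *P (q *P q) +P [ + 2 ] -P q)

  -- The hypotheses say that modulo `p` the element `Q` behaves like a primitive n-th root of unity,
  -- n = 2h + 1; this is all that is used about Φₙ(q²) here.
  module Residues (h′ : ℕ) (p : Poly) (Q^n≡1 : Mod p (powP Q (suc (suc h′ ℕ.+ suc h′))) oneP)
                  (ω-Coprime : ∀ j → suc j < suc (suc h′ ℕ.+ suc h′) → Coprime (ω (suc j)) p) where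

    h n : ℕ
    h = suc h′
    n = suc (h ℕ.+ h)

    private
      rfl : ∀ {a} → Mod p a a
      rfl = ≋⇒Mod ≋-refl

    powP-shift : ∀ {j k} → k ≡ n ℕ.+ j → Mod p (powP Q k) (powP Q j)
    powP-shift {j} refl = begin
      powP Q (n ℕ.+ j)       ≈⟨ ≋⇒Mod (powP-+ Q n j) ⟩
      powP Q n *P powP Q j   ≈⟨ Mod-*P Q^n≡1 (rfl {powP Q j}) ⟩
      oneP *P powP Q j       ≈⟨ ≋⇒Mod (*P-identityˡ (powP Q j)) ⟩
      powP Q j               ∎
      where open Mod-Reasoning p

    ω-shift : ∀ {j k} → k ≡ n ℕ.+ j → Mod p (ω k) (ω j)
    ω-shift eq = Mod-+P (rfl {oneP}) (Mod-negP (powP-shift eq))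

    ω₁-Coprime : Coprime (ω 1) p
    ω₁-Coprime = ω-Coprime 0 (s≤s (s≤s z≤n))

    geo-shift : ∀ {j k} → k ≡ n ℕ.+ j → Mod p (geo Q k) (geo Q j)
    geo-shift {j} {k} eq = Mod-cancel ω₁-Coprime (begin
      ω 1 *P geo Q k  ≈⟨ ≋⇒Mod (≋-trans (*P-comm (ω 1) (geo Q k)) (≋-sym (ω≋geo k))) ⟩
      ω k             ≈⟨ ω-shift eq ⟩
      ω j             ≈⟨ ≋⇒Mod (≋-trans (ω≋geo j) (*P-comm (geo Q j) (ω 1))) ⟩
      ω 1 *P geo Q j  ∎)
      where open Mod-Reasoning p

    ω-reflect : ∀ {j k} → j ℕ.+ k ≡ n → Mod p (ω j) (negP (powP Q j) *P ω k)
    ω-reflect {j} {k} j+k≡n = begin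
      oneP -P powP Q j                 ≈⟨ Mod-+P (Mod-sym Q^n≡1) (rfl {negP (powP Q j)}) ⟩
      powP Q n -P powP Q j             ≈⟨ ≋⇒Mod (+P-cong (≋-trans (Poly.reflexive (cong (powP Q) (sym j+k≡n))) (powP-+ Q j k))
                                            (≋-refl {negP (powP Q j)})) ⟩
      powP Q j *P powP Q k -P powP Q j ≈⟨ ≋⇒Mod (solve 2 (λ x y → x :* y :- x := (:- x) :* (con 1ℤ :- y)) ≋-refl (powP Q j) (powP Q k)) ⟩
      negP (powP Q j) *P ω k           ∎
      where open Mod-Reasoning p

    oddFact-Coprime : ∀ i → i ≤ h → Coprime (oddFact i) p
    oddFact-Coprime zero    _   = Coprime-const p λ ()
    oddFact-Coprime (suc i) i<h = Coprime-*P (oddFact-Coprime i (ℕₚ.<⇒≤ i<h)) (ω-Coprime (i ℕ.+ i) (s≤s (ℕₚ.+-mono-< i<h i<h)))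

    evenFact-Coprime : ∀ i → i ≤ h → Coprime (evenFact i) p
    evenFact-Coprime zero    _   = Coprime-const p λ ()
    evenFact-Coprime (suc i) i<h =
      Coprime-*P (evenFact-Coprime i (ℕₚ.<⇒≤ i<h)) (ω-Coprime (i ℕ.+ suc i) (s≤s (ℕₚ.+-mono-≤ i<h i<h)))

    -- (−1)^i Q^{i²}
    sign : ℕ → Poly
    sign zero    = oneP
    sign (suc i) = sign i *P negP (powP Q (suc (i ℕ.+ i)))

    -- When (i+1) + j = h, the odd exponent 2i + 1 and the even exponent 2j + 2 add up to n, so
    -- `ω-reflect` trades one factor for the other at the cost of -Q^{2i+1}. The case j = 0 is the
    -- complete pairing.
    oddFact-reflect : ∀ i j → i ℕ.+ j ≡ h → Mod p (oddFact i *P evenFact j) (sign i *P evenFact h)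
    oddFact-reflect zero    j refl = rfl
    oddFact-reflect (suc i) j eq   = begin
      oddFact i *P ω (suc (i ℕ.+ i)) *P evenFact j
        ≈⟨ Mod-*P (Mod-*P (rfl {oddFact i}) (ω-reflect {suc (i ℕ.+ i)} {suc j ℕ.+ suc j} exponents)) (rfl {evenFact j}) ⟩
      oddFact i *P (negP x *P w) *P evenFact j
        ≈⟨ ≋⇒Mod (solve 4 (λ o x w e → o :* (x :* w) :* e := o :* (e :* w) :* x) ≋-refl (oddFact i) (negP x) w (evenFact j)) ⟩
      oddFact i *P evenFact (suc j) *P negP x
        ≈⟨ Mod-*P (oddFact-reflect i (suc j) (trans (ℕₚ.+-suc i j) eq)) (rfl {negP x}) ⟩
      sign i *P evenFact h *P negP x
        ≈⟨ ≋⇒Mod (solve 3 (λ s e x → s :* e :* x := s :* x :* e) ≋-refl (sign i) (evenFact h) (negP x)) ⟩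
      sign i *P negP x *P evenFact h ∎
      where
      open Mod-Reasoning p
      x = powP Q (suc (i ℕ.+ i))
      w = ω (suc j ℕ.+ suc j)
      rearrange : ∀ i j → suc (i ℕ.+ i) ℕ.+ (suc j ℕ.+ suc j) ≡ suc ((suc i ℕ.+ j) ℕ.+ (suc i ℕ.+ j))
      rearrange = ℕRing.solve-∀
      exponents : suc (i ℕ.+ i) ℕ.+ (suc j ℕ.+ suc j) ≡ n
      exponents = trans (rearrange i j) (cong (λ k → suc (k ℕ.+ k)) eq)

    sign-square : ∀ i → sign i *P sign i ≋ powP Q (2 ℕ.* (i ℕ.* i))
    sign-square zero    = *P-identityˡ oneP
    sign-square (suc i) = begin
      sign i *P negP x *P (sign i *P negP x)
        ≈⟨ solve 2 (λ s x → s :* (:- x) :* (s :* (:- x)) := s :* s :* (x :* x)) ≋-refl (sign i) x ⟩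
      sign i *P sign i *P (x *P x)
        ≈⟨ *P-cong (sign-square i) (≋-sym (powP-+ Q (suc (i ℕ.+ i)) (suc (i ℕ.+ i)))) ⟩
      powP Q (2 ℕ.* (i ℕ.* i)) *P powP Q (suc (i ℕ.+ i) ℕ.+ suc (i ℕ.+ i))
        ≈⟨ ≋-sym (powP-+ Q (2 ℕ.* (i ℕ.* i)) (suc (i ℕ.+ i) ℕ.+ suc (i ℕ.+ i))) ⟩
      powP Q (2 ℕ.* (i ℕ.* i) ℕ.+ (suc (i ℕ.+ i) ℕ.+ suc (i ℕ.+ i)))
        ≡⟨ cong (powP Q) (exponents i) ⟩
      powP Q (2 ℕ.* (suc i ℕ.* suc i)) ∎
      where
      open ≋-Reasoning
      x = powP Q (suc (i ℕ.+ i))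
      exponents : ∀ i → 2 ℕ.* (i ℕ.* i) ℕ.+ (suc (i ℕ.+ i) ℕ.+ suc (i ℕ.+ i)) ≡ 2 ℕ.* (suc i ℕ.* suc i)
      exponents = ℕRing.solve-∀

    -- The factor 1 - Qⁿ vanishes modulo `p`, so it has to be cancelled between the q-binomial
    -- coefficient and (Q;Q²)_N as an exact polynomial identity, before any reduction.
    cofactor-relation : ∀ N c o → gauss N N *P ω 1 ≋ ω n *P c → oddFact N ≋ ω n *P o →
      c *P evenFact N ≋ o *P (plusFact N *P plusFact N) *P ω 1
    cofactor-relation N c o eq-c eq-o = *P-cancelʳ (ω n) (Q^≉1 (h ℕ.+ h)) (begin
      c *P evenFact N *P ω n        ≈⟨ solve 3 (λ c e w → c :* e :* w := w :* c :* e) ≋-refl c (evenFact N) (ω n) ⟩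
      ω n *P c *P evenFact N        ≈⟨ *P-congʳ (≋-sym eq-c) (evenFact N) ⟩
      gauss N N *P ω 1 *P evenFact N
        ≈⟨ solve 3 (λ g w e → g :* w :* e := g :* e :* w) ≋-refl (gauss N N) (ω 1) (evenFact N) ⟩
      gauss N N *P evenFact N *P ω 1 ≈⟨ *P-congʳ (≋-sym (oddFact-gauss N)) (ω 1) ⟩
      oddFact N *P W *P ω 1         ≈⟨ *P-congʳ (*P-congʳ eq-o W) (ω 1) ⟩
      ω n *P o *P W *P ω 1          ≈⟨ solve 4 (λ w o x y → w :* o :* x :* y := o :* x :* y :* w) ≋-refl (ω n) o W (ω 1) ⟩
      o *P W *P ω 1 *P ω n          ∎)
      where
      open ≋-Reasoning
      W = plusFact N *P plusFact N

    halfCatalan-residue : Mod p (halfCatalan h) (sign h *P (plusFact (suc h) *P plusFact (suc h)))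
    halfCatalan-residue = Mod-cancel (Coprime-*P (evenFact-Coprime h ℕₚ.≤-refl) ω₁-Coprime) (begin
      evenFact h *P ω 1 *P c
        -- Since 2(h+1) = n + 1, the last factor of `evenFact (suc h)` is 1 - Q modulo `p`.
        ≈⟨ Mod-*P (Mod-*P (rfl {evenFact h}) (Mod-sym (ω-shift {1} {suc h ℕ.+ suc h} (exponents h)))) (rfl {c}) ⟩
      evenFact (suc h) *P c      ≈⟨ ≋⇒Mod (*P-comm (evenFact (suc h)) c) ⟩
      c *P evenFact (suc h)
        ≈⟨ ≋⇒Mod (cofactor-relation (suc h) c (oddFact h) (gauss-halfCatalan h) (*P-comm (oddFact h) (ω n))) ⟩
      oddFact h *P W *P ω 1
        ≈⟨ Mod-*P (Mod-*P (Mod-trans (≋⇒Mod (≋-sym (Poly.*-identityʳ (oddFact h))))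
             (oddFact-reflect h 0 (ℕₚ.+-identityʳ h))) (rfl {W})) (rfl {ω 1}) ⟩
      sign h *P evenFact h *P W *P ω 1
        ≈⟨ ≋⇒Mod (solve 4 (λ s e w x → s :* e :* w :* x := e :* x :* (s :* w)) ≋-refl (sign h) (evenFact h) W (ω 1)) ⟩
      evenFact h *P ω 1 *P (sign h *P W) ∎)
      where
      open Mod-Reasoning p
      c = halfCatalan h
      W = plusFact (suc h) *P plusFact (suc h)
      exponents : ∀ h → suc h ℕ.+ suc h ≡ suc (h ℕ.+ h) ℕ.+ 1
      exponents = ℕRing.solve-∀

    -- The factors of (Q;Q²)_{h+1+l} after the one with exponent n.
    oddTail : ℕ → Poly
    oddTail zero    = oneP
    oddTail (suc l) = oddTail l *P ω (suc ((l ℕ.+ suc h) ℕ.+ (l ℕ.+ suc h)))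

    oddFact-oddTail : ∀ l → oddFact (l ℕ.+ suc h) ≋ ω n *P (oddFact h *P oddTail l)
    oddFact-oddTail zero    = solve 2 (λ o w → o :* w := w :* (o :* con 1ℤ)) ≋-refl (oddFact h) (ω n)
    oddFact-oddTail (suc l) = ≋-trans (*P-congʳ (oddFact-oddTail l) x)
      (solve 4 (λ w o t x → w :* (o :* t) :* x := w :* (o :* (t :* x))) ≋-refl (ω n) (oddFact h) (oddTail l) x)
      where x = ω (suc ((l ℕ.+ suc h) ℕ.+ (l ℕ.+ suc h)))

    -- As n is odd, reduction modulo n flips parity: odd exponents beyond n become the even ones
    -- from 2 on, and in `evenFact-shift` even exponents beyond n become the odd ones from 1 on.
    oddTail-residue : ∀ l → Mod p (oddTail l) (evenFact l)
    oddTail-residue zero    = rfl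
    oddTail-residue (suc l) = Mod-*P (oddTail-residue l) (ω-shift (exponents l h))
      where
      exponents : ∀ l h → suc ((l ℕ.+ suc h) ℕ.+ (l ℕ.+ suc h)) ≡ suc (h ℕ.+ h) ℕ.+ (suc l ℕ.+ suc l)
      exponents = ℕRing.solve-∀

    evenFact-shift : ∀ i → Mod p (evenFact (i ℕ.+ h)) (oddFact i *P evenFact h)
    evenFact-shift zero    = ≋⇒Mod (≋-sym (*P-identityˡ (evenFact h)))
    evenFact-shift (suc i) = Mod-trans
      (Mod-*P (evenFact-shift i) (ω-shift {suc (i ℕ.+ i)} (exponents i h)))
      (≋⇒Mod (solve 3 (λ o e w → o :* e :* w := o :* w :* e) ≋-refl (oddFact i) (evenFact h) (ω (suc (i ℕ.+ i)))))
      where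
      exponents : ∀ i h → suc (i ℕ.+ h) ℕ.+ suc (i ℕ.+ h) ≡ suc (h ℕ.+ h) ℕ.+ suc (i ℕ.+ i)
      exponents = ℕRing.solve-∀

    -- Here N = n - 1 = 2h. The tail of (Q;Q²)_N reduces to (Q²;Q²)_{h-1}; one more factor 1 -
    -- Q^{2h} = 1 - Q^N completes it to (Q²;Q²)_h, and both sides then contain `e`. The factor is
    -- supplied by 1 - Q ≡ -Q(1 - Q^N), from 1 + N = n, which is the source of -Q.
    catalan-residue : Mod p (catalan (h′ ℕ.+ h)) (negP Q *P (plusFact (h ℕ.+ h) *P plusFact (h ℕ.+ h)))
    catalan-residue = Mod-cancel ω₁-Coprime (begin
      ω 1 *P c                           ≈⟨ Mod-*P (ω-reflect {1} {N} refl) (rfl {c}) ⟩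
      negP (oneP *P Q) *P ω N *P c
        ≈⟨ ≋⇒Mod (solve 3 (λ q w c → (:- (con 1ℤ :* q)) :* w :* c := (:- q) :* (c :* w)) ≋-refl Q (ω N) c) ⟩
      negP Q *P (c *P ω N)               ≈⟨ Mod-*P (rfl {negP Q}) c*ωN ⟩
      negP Q *P (W *P ω 1)               ≈⟨ ≋⇒Mod (solve 3 (λ q w x → q :* (w :* x) := x :* (q :* w)) ≋-refl (negP Q) W (ω 1)) ⟩
      ω 1 *P (negP Q *P W)               ∎)
      where
      open Mod-Reasoning p
      N = h ℕ.+ h
      c = catalan (h′ ℕ.+ h)
      W = plusFact N *P plusFact N
      e = oddFact h *P evenFact h
      o = oddFact h *P oddTail h′
      oddFact-split : oddFact N ≋ ω n *P o
      oddFact-split = ≋-trans (Poly.reflexive (cong oddFact (sym (ℕₚ.+-suc h′ h)))) (oddFact-oddTail h′)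
      c*ωN : Mod p (c *P ω N) (W *P ω 1)
      c*ωN = Mod-cancel (Coprime-*P (oddFact-Coprime h ℕₚ.≤-refl) (evenFact-Coprime h ℕₚ.≤-refl)) (begin
        e *P (c *P ω N)            ≈⟨ Mod-*P (Mod-sym (evenFact-shift h)) (rfl {c *P ω N}) ⟩
        evenFact N *P (c *P ω N)
          ≈⟨ ≋⇒Mod (solve 3 (λ e c w → e :* (c :* w) := c :* e :* w) ≋-refl (evenFact N) c (ω N)) ⟩
        c *P evenFact N *P ω N
          ≈⟨ ≋⇒Mod (*P-congʳ (cofactor-relation N c o (gauss-catalan (h′ ℕ.+ h)) oddFact-split) (ω N)) ⟩
        oddFact h *P oddTail h′ *P W *P ω 1 *P ω N
          ≈⟨ ≋⇒Mod (solve 5 (λ o t w x y → o :* t :* w :* x :* y := o :* (t :* y) :* (w :* x)) ≋-refl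
               (oddFact h) (oddTail h′) W (ω 1) (ω N)) ⟩
        oddFact h *P (oddTail h′ *P ω N) *P (W *P ω 1)
          ≈⟨ Mod-*P (Mod-*P (rfl {oddFact h}) (Mod-*P (oddTail-residue h′) (rfl {ω N}))) (rfl {W *P ω 1}) ⟩
        e *P (W *P ω 1) ∎)

    module _ (q : Poly) (Q≋q² : Q ≋ q *P q) where

      -- 4h² = (2h - 1)(2h + 1) + 1 and Qⁿ ≡ 1.
      sign-fourth : Mod p (powP (sign h) 4) Q
      sign-fourth = begin
        powP (sign h) 4
          ≈⟨ ≋⇒Mod (solve 1 (λ s → con 1ℤ :* s :* s :* s :* s := s :* s :* (s :* s)) ≋-refl (sign h)) ⟩
        sign h *P sign h *P (sign h *P sign h)
          ≈⟨ ≋⇒Mod (≋-trans (*P-cong (sign-square h) (sign-square h))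
               (≋-sym (powP-+ Q (2 ℕ.* (h ℕ.* h)) (2 ℕ.* (h ℕ.* h))))) ⟩
        powP Q (2 ℕ.* (h ℕ.* h) ℕ.+ 2 ℕ.* (h ℕ.* h))   ≡⟨ cong (powP Q) (exponents h′) ⟩
        powP Q (suc ((h ℕ.+ h′) ℕ.* n))                ≈⟨ Mod-*P (≋⇒Mod (powP-* Q (h ℕ.+ h′) n)) (rfl {Q}) ⟩
        powP (powP Q n) (h ℕ.+ h′) *P Q                ≈⟨ Mod-*P (Mod-powP Q^n≡1 (h ℕ.+ h′)) (rfl {Q}) ⟩
        powP oneP (h ℕ.+ h′) *P Q                      ≈⟨ ≋⇒Mod (≋-trans (*P-congʳ (powP-oneP (h ℕ.+ h′)) Q) (*P-identityˡ Q)) ⟩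
        Q                                              ∎
        where
        open Mod-Reasoning p
        exponents : ∀ k → 2 ℕ.* (suc k ℕ.* suc k) ℕ.+ 2 ℕ.* (suc k ℕ.* suc k)
                        ≡ suc ((suc k ℕ.+ k) ℕ.* suc (suc k ℕ.+ suc k))
        exponents = ℕRing.solve-∀

      fourth-power : ∀ {c r t} s W → Mod p c (s *P W) → Mod p (powP s 4 *P r) t → Mod p (powP c 4 *P r) (t *P powP W 4)
      fourth-power {c} {r} {t} s W c≡ sr≡ = begin
        powP c 4 *P r               ≈⟨ Mod-*P (Mod-trans (Mod-powP c≡ 4) (≋⇒Mod (powP-distrib-*P s W 4))) (rfl {r}) ⟩
        powP s 4 *P powP W 4 *P r   ≈⟨ ≋⇒Mod (solve 3 (λ s w r → s :* w :* r := s :* r :* w) ≋-refl (powP s 4) (powP W 4) r) ⟩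
        powP s 4 *P r *P powP W 4   ≈⟨ Mod-*P sr≡ (rfl {powP W 4}) ⟩
        t *P powP W 4               ∎
        where open Mod-Reasoning p

      -- For N = h + 1, 2N = n + 1, so [2N], [2N+1] and Q^{2N} reduce to 1, 1 + Q and Q.
      halfCatalan-weight : Mod p (powP (halfCatalan h) 4 *P weight q (suc h))
                                 (target q *P powP (plusFact (suc h) *P plusFact (suc h)) 4)
      halfCatalan-weight = fourth-power (sign h) (plusFact (suc h) *P plusFact (suc h)) halfCatalan-residue (begin
        powP (sign h) 4 *P weight q (suc h)
          ≈⟨ Mod-*P sign-fourth (Mod-+P (Mod-*P (Mod-*P (rfl {[ + 2 ] *P q}) (geo-shift {1} (exponents h)))
               (geo-shift {2} (trans (cong suc (exponents h)) (sym (ℕₚ.+-suc n 1)))))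
               (Mod-negP (powP-shift {1} (exponents h)))) ⟩
        Q *P ([ + 2 ] *P q *P geo Q 1 *P geo Q 2 -P powP Q 1)
          ≈⟨ ≋⇒Mod (solve 2 (λ Q q → Q :* (con (+ 2) :* q :* con 1ℤ :* (con 1ℤ :+ con 1ℤ :* Q) :- con 1ℤ :* Q)
               := Q :* (con (+ 2) :* q :* (con 1ℤ :+ Q) :- Q)) ≋-refl Q q) ⟩
        Q *P ([ + 2 ] *P q *P (oneP +P Q) -P Q)
          ≈⟨ ≋⇒Mod (*P-cong Q≋q² (+P-cong (*P-congˡ ([ + 2 ] *P q) (+P-cong (≋-refl {oneP}) Q≋q²)) (negP-cong Q≋q²))) ⟩
        q *P q *P ([ + 2 ] *P q *P (oneP +P q *P q) -P q *P q)
          ≈⟨ ≋⇒Mod (solve 1 (λ q → q :* q :* (con (+ 2) :* q :* (con 1ℤ :+ q :* q) :- q :* q)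
               := q :* q :* q :* (con (+ 2) :* (q :* q) :+ con (+ 2) :- q)) ≋-refl q) ⟩
        target q ∎)
        where
        open Mod-Reasoning p
        exponents : ∀ h → suc h ℕ.+ suc h ≡ suc (h ℕ.+ h) ℕ.+ 1
        exponents = ℕRing.solve-∀

      -- For N = 2h, 2N = 2n - 2, and the residues of [2N] and [2N+1] would involve Q⁻¹. The factor
      -- (-Q)⁴ avoids this: each bracket takes up Q² and is rewritten through the index `m` = 2n,
      -- where [m] ≡ 0 and Q^m ≡ 1.
      catalan-weight : Mod p (powP (catalan (h′ ℕ.+ h)) 4 *P weight q (h ℕ.+ h))
                             (target q *P powP (plusFact (h ℕ.+ h) *P plusFact (h ℕ.+ h)) 4)
      catalan-weight = fourth-power (negP Q) (plusFact (h ℕ.+ h) *P plusFact (h ℕ.+ h)) catalan-residue (begin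
        powP (negP Q) 4 *P ([ + 2 ] *P q *P g *P (g +P y) -P y)
          ≈⟨ ≋⇒Mod (solve 4 (λ Q q g y →
               con 1ℤ :* (:- Q) :* (:- Q) :* (:- Q) :* (:- Q) :* (con (+ 2) :* q :* g :* (g :+ y) :- y)
               := con (+ 2) :* q :* ((g :+ y :+ y :* Q) :* (Q :* Q) :- y :* Q :* Q :* (con 1ℤ :+ Q))
                    :* ((g :+ y :+ y :* Q) :* (Q :* Q) :- y :* Q :* Q :* Q) :- y :* Q :* Q :* (Q :* Q)) ≋-refl Q q g y) ⟩
        [ + 2 ] *P q *P (geo Q m *P (Q *P Q) -P powP Q m *P (oneP +P Q)) *P (geo Q m *P (Q *P Q) -P powP Q m *P Q)
          -P powP Q m *P (Q *P Q)
          ≈⟨ Mod-+P (Mod-*P (Mod-*P (rfl {[ + 2 ] *P q}) (expand (oneP +P Q))) (expand Q))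
               (Mod-negP (Mod-*P Q^m≡1 (rfl {Q *P Q}))) ⟩
        [ + 2 ] *P q *P ([] *P (Q *P Q) -P oneP *P (oneP +P Q)) *P ([] *P (Q *P Q) -P oneP *P Q) -P oneP *P (Q *P Q)
          ≈⟨ ≋⇒Mod (solve 2 (λ Q q → con (+ 2) :* q :* (:- (con 1ℤ :* (con 1ℤ :+ Q))) :* (:- (con 1ℤ :* Q)) :- con 1ℤ :* (Q :* Q)
               := Q :* (con (+ 2) :* q :* (con 1ℤ :+ Q) :- Q)) ≋-refl Q q) ⟩
        Q *P ([ + 2 ] *P q *P (oneP +P Q) -P Q)
          ≈⟨ ≋⇒Mod (*P-cong Q≋q² (+P-cong (*P-congˡ ([ + 2 ] *P q) (+P-cong (≋-refl {oneP}) Q≋q²)) (negP-cong Q≋q²))) ⟩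
        q *P q *P ([ + 2 ] *P q *P (oneP +P q *P q) -P q *P q)
          ≈⟨ ≋⇒Mod (solve 1 (λ q → q :* q :* (con (+ 2) :* q :* (con 1ℤ :+ q :* q) :- q :* q)
               := q :* q :* q :* (con (+ 2) :* (q :* q) :+ con (+ 2) :- q)) ≋-refl q) ⟩
        target q ∎)
        where
        open Mod-Reasoning p
        g = geo Q ((h ℕ.+ h) ℕ.+ (h ℕ.+ h))
        y = powP Q ((h ℕ.+ h) ℕ.+ (h ℕ.+ h))
        m = suc (suc ((h ℕ.+ h) ℕ.+ (h ℕ.+ h)))
        m≡n+n : m ≡ n ℕ.+ n
        m≡n+n = cong suc (sym (ℕₚ.+-suc (h ℕ.+ h) (h ℕ.+ h)))
        Q^m≡1 : Mod p (powP Q m) oneP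
        Q^m≡1 = Mod-trans (powP-shift m≡n+n) Q^n≡1
        geo-m≡0 : Mod p (geo Q m) []
        geo-m≡0 = Mod-trans (geo-shift m≡n+n) (geo-shift (sym (ℕₚ.+-identityʳ n)))
        expand : ∀ a → Mod p (geo Q m *P (Q *P Q) -P powP Q m *P a) ([] *P (Q *P Q) -P oneP *P a)
        expand a = Mod-+P (Mod-*P geo-m≡0 (rfl {Q *P Q})) (Mod-negP (Mod-*P Q^m≡1 (rfl {a})))

-- Fractions

-- `A` equals a/b as a rational function. Operations on `Frac` never reduce, so the actual
-- numerators and denominators of the sums are unwieldy products; computations use such
-- representatives instead.
record Rep (A : Frac) (a b : Poly) : Set where
  constructor rep
  field
    den≉[]  : ¬ (den A ≋ [])
    b≉[]    : ¬ (b ≋ [])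
    crossed : num A *P b ≋ a *P den A

Rep-refl : ∀ {A} → ¬ (den A ≋ []) → Rep A (num A) (den A)
Rep-refl d≉0 = rep d≉0 d≉0 ≋-refl

Rep-conv : ∀ {A a b c d} → Rep A a b → ¬ (d ≋ []) → a *P d ≋ c *P b → Rep A c d
Rep-conv {A} {a} {b} {c} {d} (rep A≉0 b≉0 eq) d≉0 ad≋cb = rep A≉0 d≉0 (*P-cancelʳ b b≉0 (begin
  num A *P d *P b    ≈⟨ solve 3 (λ n d b → n :* d :* b := n :* b :* d) ≋-refl (num A) d b ⟩
  num A *P b *P d    ≈⟨ *P-congʳ eq d ⟩
  a *P den A *P d    ≈⟨ solve 3 (λ a e d → a :* e :* d := a :* d :* e) ≋-refl a (den A) d ⟩
  a *P d *P den A    ≈⟨ *P-congʳ ad≋cb (den A) ⟩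
  c *P b *P den A    ≈⟨ solve 3 (λ c b e → c :* b :* e := c :* e :* b) ≋-refl c b (den A) ⟩
  c *P den A *P b    ∎))
  where open ≋-Reasoning

Rep-*F : ∀ {A B a b c d} → Rep A a b → Rep B c d → Rep (A *F B) (a *P c) (b *P d)
Rep-*F {A} {B} {a} {b} {c} {d} (rep A≉0 b≉0 eqA) (rep B≉0 d≉0 eqB) = rep (*P-≉[] A≉0 B≉0) (*P-≉[] b≉0 d≉0) (begin
  num A *P num B *P (b *P d)    ≈⟨ solve 4 (λ m n b d → m :* n :* (b :* d) := m :* b :* (n :* d)) ≋-refl (num A) (num B) b d ⟩
  num A *P b *P (num B *P d)    ≈⟨ *P-cong eqA eqB ⟩
  a *P den A *P (c *P den B)    ≈⟨ solve 4 (λ m n b d → m :* n :* (b :* d) := m :* b :* (n :* d)) ≋-refl a (den A) c (den B) ⟩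
  a *P c *P (den A *P den B)    ∎)
  where open ≋-Reasoning

Rep-+F : ∀ {A B a b c d} → Rep A a b → Rep B c d → Rep (A +F B) (a *P d +P c *P b) (b *P d)
Rep-+F {A} {B} {a} {b} {c} {d} (rep A≉0 b≉0 eqA) (rep B≉0 d≉0 eqB) = rep (*P-≉[] A≉0 B≉0) (*P-≉[] b≉0 d≉0) (begin
  (num A *P den B +P num B *P den A) *P (b *P d)
    ≈⟨ solve 6 (λ m e n f b d → (m :* f :+ n :* e) :* (b :* d) := m :* b :* (f :* d) :+ n :* d :* (e :* b)) ≋-refl
         (num A) (den A) (num B) (den B) b d ⟩
  num A *P b *P (den B *P d) +P num B *P d *P (den A *P b)
    ≈⟨ +P-cong (*P-congʳ eqA (den B *P d)) (*P-congʳ eqB (den A *P b)) ⟩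
  a *P den A *P (den B *P d) +P c *P den B *P (den A *P b)
    ≈⟨ solve 6 (λ a e c f b d → a :* e :* (f :* d) :+ c :* f :* (e :* b) := (a :* d :+ c :* b) :* (e :* f)) ≋-refl
         a (den A) c (den B) b d ⟩
  (a *P d +P c *P b) *P (den A *P den B) ∎)
  where open ≋-Reasoning

Rep--F : ∀ {A B a b c d} → Rep A a b → Rep B c d → Rep (A -F B) (a *P d -P c *P b) (b *P d)
Rep--F {A} {B} {a} {b} {c} {d} (rep A≉0 b≉0 eqA) (rep B≉0 d≉0 eqB) = rep (*P-≉[] A≉0 B≉0) (*P-≉[] b≉0 d≉0) (begin
  (num A *P den B -P num B *P den A) *P (b *P d)
    ≈⟨ solve 6 (λ m e n f b d → (m :* f :- n :* e) :* (b :* d) := m :* b :* (f :* d) :- n :* d :* (e :* b)) ≋-refl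
         (num A) (den A) (num B) (den B) b d ⟩
  num A *P b *P (den B *P d) -P num B *P d *P (den A *P b)
    ≈⟨ +P-cong (*P-congʳ eqA (den B *P d)) (negP-cong (*P-congʳ eqB (den A *P b))) ⟩
  a *P den A *P (den B *P d) -P c *P den B *P (den A *P b)
    ≈⟨ solve 6 (λ a e c f b d → a :* e :* (f :* d) :- c :* f :* (e :* b) := (a :* d :- c :* b) :* (e :* f)) ≋-refl
         a (den A) c (den B) b d ⟩
  (a *P d -P c *P b) *P (den A *P den B) ∎)
  where open ≋-Reasoning

Rep-÷F : ∀ {A B a b c d} → Rep A a b → Rep B c d → ¬ (c ≋ []) → Rep (A ÷F B) (a *P d) (b *P c)
Rep-÷F {A} {B} {a} {b} {c} {d} (rep A≉0 b≉0 eqA) (rep B≉0 d≉0 eqB) c≉0 = rep (*P-≉[] A≉0 numB≉0) (*P-≉[] b≉0 c≉0) (begin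
  num A *P den B *P (b *P c)    ≈⟨ solve 4 (λ m f b c → m :* f :* (b :* c) := m :* b :* (c :* f)) ≋-refl (num A) (den B) b c ⟩
  num A *P b *P (c *P den B)    ≈⟨ *P-cong eqA (≋-sym eqB) ⟩
  a *P den A *P (num B *P d)    ≈⟨ solve 4 (λ a e n d → a :* e :* (n :* d) := a :* d :* (e :* n)) ≋-refl a (den A) (num B) d ⟩
  a *P d *P (den A *P num B)    ∎)
  where
  open ≋-Reasoning
  numB≉0 : ¬ (num B ≋ [])
  numB≉0 e = *P-≉[] c≉0 B≉0 (≋-trans (≋-sym eqB) (*P-zeroˡ e d))

oneF-Rep : Rep oneF oneP oneP
oneF-Rep = Rep-refl (const≉[] λ ())

powP-≉[] : ∀ {p} → ¬ (p ≋ []) → ∀ k → ¬ (powP p k ≋ [])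
powP-≉[] p≉0 zero    = const≉[] λ ()
powP-≉[] p≉0 (suc k) = *P-≉[] (powP-≉[] p≉0 k) p≉0

Rep-powF : ∀ {A a b} → Rep A a b → ∀ k → Rep (powF A k) (powP a k) (powP b k)
Rep-powF r zero    = oneF-Rep
Rep-powF r (suc k) = Rep-*F (Rep-powF r k) r

Rep-1- : ∀ {A a b} → Rep A a b → Rep (oneF -F A) (b -P a) b
Rep-1- {A} {a} {b} r = Rep-conv (Rep--F oneF-Rep r) (Rep.b≉[] r)
  (solve 2 (λ a b → (con 1ℤ :* b :- a :* con 1ℤ) :* b := (b :- a) :* (con 1ℤ :* b)) ≋-refl a b)

-- Powers of q, q-integers and shifted factorials as fractions

X^≉[] : ∀ n → ¬ (X^ n ≋ [])
X^≉[] n = Monic-≉[] (Monic-X^ n)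

-- One form for both signs of the exponent; it covers 4k - 1, which is negative at k = 0.
qpow-⊖ : ∀ a b → Rep (qpow (a ℤ.⊖ b)) (X^ a) (X^ b)
qpow-⊖ a b with b ℕ.≤? a
... | yes b≤a rewrite ℤₚ.⊖-≥ b≤a = rep (const≉[] λ ()) (X^≉[] b) (begin
    X^ (a ∸ b) *P X^ b      ≈⟨ ≋-sym (X^-+ (a ∸ b) b) ⟩
    X^ (a ∸ b ℕ.+ b)        ≡⟨ cong X^ (ℕₚ.m∸n+n≡m b≤a) ⟩
    X^ a                    ≈⟨ ≋-sym (Poly.*-identityʳ (X^ a)) ⟩
    X^ a *P oneP            ∎)
  where open ≋-Reasoning
... | no b≰a rewrite ℤₚ.⊖-< (ℕₚ.≰⇒> b≰a) with b ∸ a | ℕₚ.m+[n∸m]≡n (ℕₚ.<⇒≤ (ℕₚ.≰⇒> b≰a))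
...   | zero  | a+0≡b = contradiction (ℕₚ.≤-reflexive (trans (sym a+0≡b) (ℕₚ.+-identityʳ a))) b≰a
...   | suc j | a+j≡b = rep (X^≉[] (suc j)) (X^≉[] b) (begin
    oneP *P X^ b            ≈⟨ *P-identityˡ (X^ b) ⟩
    X^ b                    ≡⟨ cong X^ (sym a+j≡b) ⟩
    X^ (a ℕ.+ suc j)        ≈⟨ X^-+ a (suc j) ⟩
    X^ a *P X^ (suc j)      ∎)
  where open ≋-Reasoning

1-X^≉[] : ∀ e → ¬ (oneP -P X^ (suc e) ≋ [])
1-X^≉[] e eq = unity≉[] {suc e} (s≤s z≤n) (≋-trans
  (solve 1 (λ x → x :- con 1ℤ := (:- (con 1ℤ :- x))) ≋-refl (X^ (suc e))) (negP-cong eq))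

qpow-Rep : ∀ n → Rep (qpow (+ n)) (X^ n) oneP
qpow-Rep n = Rep-refl (const≉[] λ ())

qpow⁻-Rep : ∀ n → Rep (qpow -[1+ n ]) oneP (X^ (suc n))
qpow⁻-Rep n = Rep-refl (X^≉[] (suc n))

qint-Rep : ∀ e {m a b} → Rep (qpow (+ suc e ℤ.* m)) a b → Rep (qint (suc e) m) (b -P a) (b *P (oneP -P X^ (suc e)))
qint-Rep e {m} {a} {b} r = Rep-conv (Rep-÷F (Rep-1- r) (Rep-1- (qpow-Rep (suc e))) (1-X^≉[] e))
  (*P-≉[] (Rep.b≉[] r) (1-X^≉[] e)) (*P-congʳ (Poly.*-identityʳ (b -P a)) (b *P (oneP -P X^ (suc e))))

qint-shifted : ∀ e k → Rep (qint (suc e) (+ k ℤ.- 1ℤ)) (X^ (suc e) -P powP (X^ k) (suc e)) (X^ (suc e) *P (oneP -P X^ (suc e)))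
qint-shifted e k = Rep-conv r (Rep.b≉[] r) (*P-congʳ (+P-cong (≋-refl {X^ (suc e)}) (negP-cong (X^-* (suc e) k))) _)
  where
  exponent : + suc e ℤ.* (+ k ℤ.- 1ℤ) ≡ (suc e ℕ.* k) ℤ.⊖ suc e
  exponent = trans (ℤₚ.*-distribˡ-+ (+ suc e) (+ k) (ℤ.- 1ℤ))
    (trans (cong₂ ℤ._+_ (sym (ℤₚ.pos-* (suc e) k))
      (trans (sym (ℤₚ.neg-distribʳ-* (+ suc e) 1ℤ)) (cong ℤ.-_ (ℤₚ.*-identityʳ (+ suc e)))))
    (ℤₚ.[+m]-[+n]≡m⊖n (suc e ℕ.* k) (suc e)))
  r = qint-Rep e (subst (λ i → Rep (qpow i) (X^ (suc e ℕ.* k)) (X^ (suc e))) (sym exponent) (qpow-⊖ (suc e ℕ.* k) (suc e)))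

q Q : Poly
q = X^ 1
Q = X^ 2

Q^≉1 : ∀ k → ¬ (oneP -P powP Q (suc k) ≋ [])
Q^≉1 k eq = 1-X^≉[] (suc (k ℕ.* 2)) (≋-trans (+P-cong (≋-refl {oneP}) (negP-cong (X^-* (suc k) 2))) eq)

open QProducts Q Q^≉1

powP-X^4 : ∀ i → powP (X^ 4) i ≋ powP Q (i ℕ.+ i)
powP-X^4 i = begin
  powP (X^ 4) i           ≈⟨ ≋-sym (X^-* i 4) ⟩
  X^ (i ℕ.* 4)            ≡⟨ cong X^ (exponents i) ⟩
  X^ ((i ℕ.+ i) ℕ.* 2)    ≈⟨ X^-* (i ℕ.+ i) 2 ⟩
  powP Q (i ℕ.+ i)        ∎
  where
  open ≋-Reasoning
  exponents : ∀ i → i ℕ.* 4 ≡ (i ℕ.+ i) ℕ.* 2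
  exponents = ℕRing.solve-∀

powF-q⁴ : ∀ i → Rep (powF (qpow (+ 4)) i) (powP Q (i ℕ.+ i)) oneP
powF-q⁴ i = Rep-conv (Rep-powF (qpow-Rep 4) i) (const≉[] λ ())
  (*P-cong (powP-X^4 i) (≋-sym (powP-oneP i)))

poch-even : ∀ k → Rep (poch (qpow (+ 4)) (qpow (+ 4)) k) (evenFact k) oneP
poch-even zero    = oneF-Rep
poch-even (suc k) = Rep-conv (Rep-*F (poch-even k) (Rep-1- (Rep-*F (qpow-Rep 4) (powF-q⁴ k)))) (const≉[] λ ()) (begin
  evenFact k *P (oneP *P oneP -P X^ 4 *P y) *P oneP
    ≈⟨ solve 2 (λ e z → e :* (con 1ℤ :* con 1ℤ :- z) :* con 1ℤ := e :* (con 1ℤ :- z) :* (con 1ℤ :* (con 1ℤ :* con 1ℤ)))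
         ≋-refl (evenFact k) (X^ 4 *P y) ⟩
  evenFact k *P (oneP -P X^ 4 *P y) *P (oneP *P (oneP *P oneP))
    ≈⟨ *P-congʳ (*P-congˡ (evenFact k) (+P-cong (≋-refl {oneP}) (negP-cong exponents))) (oneP *P (oneP *P oneP)) ⟩
  evenFact k *P ω (suc k ℕ.+ suc k) *P (oneP *P (oneP *P oneP)) ∎)
  where
  open ≋-Reasoning
  y = powP Q (k ℕ.+ k)
  exponents : X^ 4 *P y ≋ powP Q (suc k ℕ.+ suc k)
  exponents = ≋-trans (≋-sym (powP-+ Q 2 (k ℕ.+ k))) (Poly.reflexive (cong (powP Q) (cong suc (sym (ℕₚ.+-suc k k)))))

-- q⁻² is Q⁻¹, so the first factor is 1 - Q⁻¹ = -(1 - Q)/Q, and the remaining ones are those of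
-- (Q;Q²)_k. The shift of index is why the term k = 0 is treated separately.
poch-odd : ∀ k → Rep (poch (qpow -[1+ 1 ]) (qpow (+ 4)) (suc k)) (negP (ω 1) *P oddFact k) Q
poch-odd zero    = Rep-conv (Rep-*F oneF-Rep (Rep-1- (Rep-*F (qpow⁻-Rep 1) (powF-q⁴ 0)))) (X^≉[] 2)
  (solve 1 (λ Q → con 1ℤ :* (Q :* con 1ℤ :- con 1ℤ :* con 1ℤ) :* Q
               := (:- (con 1ℤ :- con 1ℤ :* Q)) :* con 1ℤ :* (con 1ℤ :* (Q :* con 1ℤ))) ≋-refl Q)
poch-odd (suc k) = Rep-conv (Rep-*F (poch-odd k) (Rep-1- (Rep-*F (qpow⁻-Rep 1) (powF-q⁴ (suc k))))) (X^≉[] 2) (begin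
  a *P (Q *P oneP -P oneP *P powP Q (suc k ℕ.+ suc k)) *P Q
    ≡⟨ cong (λ j → a *P (Q *P oneP -P oneP *P powP Q (suc j)) *P Q) (ℕₚ.+-suc k k) ⟩
  a *P (Q *P oneP -P oneP *P (y *P Q)) *P Q
    ≈⟨ solve 4 (λ b o y Q → b :* o :* (Q :* con 1ℤ :- con 1ℤ :* (y :* Q)) :* Q
                  := b :* (o :* (con 1ℤ :- y)) :* (Q :* (Q :* con 1ℤ))) ≋-refl (negP (ω 1)) (oddFact k) y Q ⟩
  negP (ω 1) *P (oddFact k *P ω (suc (k ℕ.+ k))) *P (Q *P (Q *P oneP)) ∎)
  where
  open ≋-Reasoning
  a = negP (ω 1) *P oddFact k
  y = powP Q (suc (k ℕ.+ k))

-- The telescoping sum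

X^-4* : ∀ k → X^ (4 ℕ.* k) ≋ powP Q (k ℕ.+ k)
X^-4* k = ≋-trans (Poly.reflexive (cong X^ (ℕₚ.*-comm 4 k))) (≋-trans (X^-* k 4) (powP-X^4 k))

qint₂-Rep : ∀ k → Rep (qint 2 (+ (4 ℕ.* k) ℤ.- 1ℤ)) (Q -P powP Q (k ℕ.+ k) *P powP Q (k ℕ.+ k)) (Q *P (oneP -P Q))
qint₂-Rep k = Rep-conv r (Rep.b≉[] r) (*P-congʳ (+P-cong (≋-refl {Q}) (negP-cong
    (≋-trans (powP-cong (X^-4* k) 2) (*P-congʳ (*P-identityˡ y) y)))) (Q *P (oneP -P Q)))
  where
  r = qint-shifted 1 (4 ℕ.* k)
  y = powP Q (k ℕ.+ k)

qint₁-Rep : ∀ k → Rep (qint 1 (+ (4 ℕ.* k) ℤ.- 1ℤ)) (q -P powP Q (k ℕ.+ k)) (q *P (oneP -P q))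
qint₁-Rep k = Rep-conv r (Rep.b≉[] r) (*P-congʳ (+P-cong (≋-refl {q}) (negP-cong
    (≋-trans (powP-cong (X^-4* k) 1) (*P-identityˡ y)))) (q *P (oneP -P q)))
  where
  r = qint-shifted 0 (4 ℕ.* k)
  y = powP Q (k ℕ.+ k)

-- The term of index k+1, up to the factor ((Q;Q²)_k / (Q²;Q²)_{k+1})⁴ / Q², as a polynomial in u = Q^{2k}.
step : Poly → Poly
step u = (oneP -P Q *P Q *P Q *P u *P u) *P ((oneP -P q *P Q *P u) *P (oneP -P q *P Q *P u))
  *P (oneP -P Q) *P ((oneP +P q) *P (oneP +P q)) *P u

powP-suc-double : ∀ k → powP Q (suc k ℕ.+ suc k) ≋ Q *P Q *P powP Q (k ℕ.+ k)
powP-suc-double k = ≋-trans (Poly.reflexive (cong (λ j → powP Q (suc j)) (ℕₚ.+-suc k k)))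
  (solve 2 (λ y Q → y :* Q :* Q := Q :* Q :* y) ≋-refl (powP Q (k ℕ.+ k)) Q)

-- [-1]_{q²} is -q⁻² and [-1]² is q⁻².
term-zero : Rep (term 0) (negP oneP) (Q *P Q)
term-zero = Rep-conv
  (Rep-*F (Rep-*F (Rep-*F (qint₂-Rep 0) (Rep-powF (qint₁-Rep 0) 2))
    (Rep-÷F (Rep-powF oneF-Rep 4) (Rep-powF oneF-Rep 4) (powP-≉[] {oneP} (const≉[] λ ()) 4))) (qpow-Rep 0))
  (*P-≉[] (X^≉[] 2) (X^≉[] 2)) ≋-refl

-- The shifted factorial contributes (1 - Q)⁴. One factor 1 - Q cancels the denominator of the
-- q²-integer, and two more, split as (1 - q)(1 + q), cancel the (1 - q)² of the squared q-integer
-- and leave (1 + q)²; one factor 1 - Q remains in `step`.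
term-suc : ∀ k → Rep (term (suc k)) (step (powP Q (k ℕ.+ k)) *P powP (oddFact k) 4) (Q *P Q *P powP (evenFact (suc k)) 4)
term-suc k = Rep-conv
  (Rep-*F (Rep-*F (Rep-*F int₂ (Rep-powF int₁ 2))
    (Rep-÷F (Rep-powF (poch-odd k) 4) (Rep-powF (poch-even (suc k)) 4) (powP-≉[] (evenFact≉[] (suc k)) 4))) pow)
  (*P-≉[] (*P-≉[] (X^≉[] 2) (X^≉[] 2)) (powP-≉[] (evenFact≉[] (suc k)) 4))
  (begin
    a *P powP c 2 *P (powP (negP (ω 1) *P o) 4 *P powP oneP 4) *P (Q *P Q *P u) *P (Q *P Q *P e)
      ≈⟨ solve 6 (λ a c o u e Q → let w = con 1ℤ :- Q ; x = (:- (con 1ℤ :- con 1ℤ :* Q)) :* o in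
           a :* (con 1ℤ :* c :* c) :* (con 1ℤ :* x :* x :* x :* x :* (con 1ℤ :* con 1ℤ :* con 1ℤ :* con 1ℤ :* con 1ℤ))
             :* (Q :* Q :* u) :* (Q :* Q :* e)
           := a :* (c :* c) :* (w :* w) :* (w :* w) :* u :* (con 1ℤ :* o :* o :* o :* o)
                :* (con 1ℤ :* Q :* Q :* Q :* Q :* e)) ≋-refl a c o u e Q ⟩
    a *P (c *P c) *P (w *P w) *P (w *P w) *P u *P powP o 4 *P (powP Q 4 *P e)
      ≈⟨ *P-congʳ (*P-congʳ (*P-congʳ (*P-congˡ (a *P (c *P c) *P (w *P w)) (*P-cong w-split w-split)) u) (powP o 4)) (powP Q 4 *P e) ⟩
    a *P (c *P c) *P (w *P w) *P (v *P s *P (v *P s)) *P u *P powP o 4 *P (powP Q 4 *P e)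
      ≈⟨ solve 9 (λ a c w v s u o4 Q4 e → a :* (c :* c) :* (w :* w) :* (v :* s :* (v :* s)) :* u :* o4 :* (Q4 :* e)
           := a :* (c :* c) :* w :* (s :* s) :* u :* o4 :* (w :* (con 1ℤ :* v :* v) :* (Q4 :* e) :* con 1ℤ)) ≋-refl
           a c w v s u (powP o 4) (powP Q 4) e ⟩
    step u *P powP o 4 *P (w *P powP v 2 *P (powP Q 4 *P e) *P oneP) ∎)
  where
  open ≋-Reasoning
  u = powP Q (k ℕ.+ k)
  o = oddFact k
  e = powP (evenFact (suc k)) 4
  a = oneP -P Q *P Q *P Q *P u *P u
  c = oneP -P q *P Q *P u
  w = oneP -P Q
  v = oneP -P q
  s = oneP +P q
  w-split : w ≋ v *P s
  w-split = ≋-refl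
  int₂ : Rep (qint 2 (+ (4 ℕ.* suc k) ℤ.- 1ℤ)) a w
  int₂ = Rep-conv (qint₂-Rep (suc k)) (1-X^≉[] 1) (≋-trans
    (*P-congʳ (+P-cong (≋-refl {Q}) (negP-cong (*P-cong (powP-suc-double k) (powP-suc-double k)))) w)
    (solve 2 (λ Q u → (Q :- Q :* Q :* u :* (Q :* Q :* u)) :* (con 1ℤ :- Q)
      := (con 1ℤ :- Q :* Q :* Q :* u :* u) :* (Q :* (con 1ℤ :- Q))) ≋-refl Q u))
  int₁ : Rep (qint 1 (+ (4 ℕ.* suc k) ℤ.- 1ℤ)) c v
  int₁ = Rep-conv (qint₁-Rep (suc k)) (1-X^≉[] 0) (≋-trans
    (*P-congʳ (+P-cong (≋-refl {q}) (negP-cong (≋-trans (powP-suc-double k)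
      (*P-congʳ {Q *P Q} {q *P (q *P Q)} ≋-refl u)))) v)
    (solve 3 (λ q Q u → (q :- q :* (q :* Q) :* u) :* (con 1ℤ :- q)
      := (con 1ℤ :- q :* Q :* u) :* (q :* (con 1ℤ :- q))) ≋-refl q Q u))
  pow : Rep (qpow (+ (4 ℕ.* suc k))) (Q *P Q *P u) oneP
  pow = Rep-conv (qpow-Rep (4 ℕ.* suc k)) (const≉[] λ ()) (*P-congʳ (≋-trans (X^-4* (suc k)) (powP-suc-double k)) oneP)

-- The whole summation rests on this identity in two independent variables, where u stands for
-- Q^{2N}. Multiplying `weight q N` by (1 - Q)² turns its geometric sums into 1 - Q^{2N} and 1 -
-- Q^{2N+1} and gives `r u`, so N enters only through u.
telescope : ∀ q u → let Q = q *P q ; v = Q *P Q *P u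
                        square = λ x → x *P x
                        r = λ y → [ + 2 ] *P q *P (oneP -P y) *P (oneP -P y *P Q) -P y *P square (oneP -P Q) in
  r v *P square (square (oneP -P u *P Q))
    ≋ r u *P square (square (oneP -P v))
      +P (oneP -P Q *P Q *P Q *P u *P u) *P square (oneP -P q *P Q *P u) *P (oneP -P Q) *P square (oneP +P q) *P u
           *P square (oneP -P Q)
telescope = solve 2 (λ q u → let
    Q = q :* q
    v = Q :* Q :* u
    square = λ x → x :* x
    r = λ y → con (+ 2) :* q :* (con 1ℤ :- y) :* (con 1ℤ :- y :* Q) :- y :* square (con 1ℤ :- Q)
  in r v :* square (square (con 1ℤ :- u :* Q))
    := r u :* square (square (con 1ℤ :- v))
      :+ (con 1ℤ :- Q :* Q :* Q :* u :* u) :* square (con 1ℤ :- q :* Q :* u) :* (con 1ℤ :- Q) :* square (con 1ℤ :+ q) :* u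
           :* square (con 1ℤ :- Q)) ≋-refl

weight-telescope : ∀ N → weight q (suc N) *P powP (ω (suc (N ℕ.+ N))) 4
  ≋ weight q N *P powP (ω (suc N ℕ.+ suc N)) 4 +P step (powP Q (N ℕ.+ N))
weight-telescope N = *P-cancelʳ (w *P w) (*P-≉[] (1-X^≉[] 1) (1-X^≉[] 1)) (begin
  weight q (suc N) *P powP o 4 *P (w *P w)
    ≈⟨ fourth (weight q (suc N)) o w ⟩
  weight q (suc N) *P (w *P w) *P (o *P o *P (o *P o))
    ≈⟨ *P-congʳ (≋-trans (weight-scaled (suc N)) (r-cong (powP-suc-double N))) (o *P o *P (o *P o)) ⟩
  r (Q *P Q *P u) *P (o *P o *P (o *P o))
    ≈⟨ telescope q u ⟩
  r u *P (b′ *P b′ *P (b′ *P b′)) +P step u *P (w *P w)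
    ≈⟨ +P-cong (*P-cong (≋-sym (weight-scaled N)) (*P-cong (*P-cong b′≋b b′≋b) (*P-cong b′≋b b′≋b))) (≋-refl {step u *P (w *P w)}) ⟩
  weight q N *P (w *P w) *P (b *P b *P (b *P b)) +P step u *P (w *P w)
    ≈⟨ +P-cong (≋-sym (fourth (weight q N) b w)) (≋-refl {step u *P (w *P w)}) ⟩
  weight q N *P powP b 4 *P (w *P w) +P step u *P (w *P w)
    ≈⟨ ≋-sym (*P-distribʳ (w *P w) (weight q N *P powP b 4) (step u)) ⟩
  (weight q N *P powP b 4 +P step u) *P (w *P w) ∎)
  where
  open ≋-Reasoning
  w = oneP -P Q
  u = powP Q (N ℕ.+ N)
  o = ω (suc (N ℕ.+ N))
  b = ω (suc N ℕ.+ suc N)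
  b′ = oneP -P Q *P Q *P u
  b′≋b : b′ ≋ b
  b′≋b = +P-cong (≋-refl {oneP}) (negP-cong (≋-sym (powP-suc-double N)))
  r : Poly → Poly
  r y = [ + 2 ] *P q *P (oneP -P y) *P (oneP -P y *P Q) -P y *P (w *P w)
  r-cong : ∀ {y z} → y ≋ z → r y ≋ r z
  r-cong e = +P-cong (*P-cong (*P-congˡ ([ + 2 ] *P q) (+P-cong (≋-refl {oneP}) (negP-cong e)))
    (+P-cong (≋-refl {oneP}) (negP-cong (*P-congʳ e Q)))) (negP-cong (*P-congʳ e (w *P w)))
  fourth : ∀ a x w → a *P powP x 4 *P (w *P w) ≋ a *P (w *P w) *P (x *P x *P (x *P x))
  fourth = solve 3 (λ a x w → a :* (con 1ℤ :* x :* x :* x :* x) :* (w :* w) := a :* (w :* w) :* (x :* x :* (x :* x))) ≋-refl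
  geo-w : ∀ k → geo Q k *P w ≋ ω k
  geo-w k = ≋-trans (*P-congˡ (geo Q k) (+P-cong (≋-refl {oneP}) (negP-cong (≋-sym (*P-identityˡ Q))))) (≋-sym (ω≋geo k))
  weight-scaled : ∀ M → weight q M *P (w *P w) ≋ r (powP Q (M ℕ.+ M))
  weight-scaled M = ≋-trans
    (solve 5 (λ q g g′ y w → (con (+ 2) :* q :* g :* g′ :- y) :* (w :* w)
        := con (+ 2) :* q :* (g :* w) :* (g′ :* w) :- y :* (w :* w)) ≋-refl
      q (geo Q (M ℕ.+ M)) (geo Q (suc (M ℕ.+ M))) (powP Q (M ℕ.+ M)) w)
    (+P-cong (*P-cong (*P-congˡ ([ + 2 ] *P q) (geo-w (M ℕ.+ M))) (geo-w (suc (M ℕ.+ M))))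
      (≋-refl {negP (powP Q (M ℕ.+ M) *P (w *P w))}))

sum-Rep : ∀ N → Rep (sumF term (suc N)) (weight q N *P powP (oddFact N) 4) (Q *P Q *P powP (evenFact N) 4)
-- `weight q 0` is -1 because [0]_Q = 0, in agreement with `term-zero`; the identity is between
-- closed coefficient lists and holds by evaluation.
sum-Rep zero    = Rep-conv (Rep-+F (Rep-refl {zeroF} (const≉[] λ ())) term-zero)
  (*P-≉[] (*P-≉[] (X^≉[] 2) (X^≉[] 2)) (powP-≉[] {oneP} (const≉[] λ ()) 4)) (≈P⇒≋ refl)
sum-Rep (suc N) = Rep-conv (Rep-+F (sum-Rep N) (term-suc N))
  (*P-≉[] (*P-≉[] (X^≉[] 2) (X^≉[] 2)) (powP-≉[] (evenFact≉[] (suc N)) 4)) (begin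
    (x *P O4 *P (Q2 *P E4′) +P t *P O4 *P (Q2 *P E4)) *P (Q2 *P E4′)
      ≈⟨ *P-congʳ (+P-cong (*P-congˡ (x *P O4) (*P-congˡ Q2 (powP-distrib-*P (evenFact N) b 4))) (≋-refl {t *P O4 *P (Q2 *P E4)})) (Q2 *P E4′) ⟩
    (x *P O4 *P (Q2 *P (E4 *P powP b 4)) +P t *P O4 *P (Q2 *P E4)) *P (Q2 *P E4′)
      ≈⟨ solve 7 (λ x O4 Q2 E4 b4 t E4′ → (x :* O4 :* (Q2 :* (E4 :* b4)) :+ t :* O4 :* (Q2 :* E4)) :* (Q2 :* E4′)
           := (x :* b4 :+ t) :* O4 :* (Q2 :* E4 :* (Q2 :* E4′))) ≋-refl x O4 Q2 E4 (powP b 4) t E4′ ⟩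
    (x *P powP b 4 +P t) *P O4 *P (Q2 *P E4 *P (Q2 *P E4′))
      ≈⟨ *P-congʳ (*P-congʳ (≋-sym (weight-telescope N)) O4) (Q2 *P E4 *P (Q2 *P E4′)) ⟩
    weight q (suc N) *P powP o 4 *P O4 *P (Q2 *P E4 *P (Q2 *P E4′))
      ≈⟨ *P-congʳ (≋-trans (solve 3 (λ x o O → x :* o :* O := x :* (O :* o)) ≋-refl (weight q (suc N)) (powP o 4) O4)
           (*P-congˡ (weight q (suc N)) (≋-sym (powP-distrib-*P (oddFact N) o 4)))) (Q2 *P E4 *P (Q2 *P E4′)) ⟩
    weight q (suc N) *P powP (oddFact (suc N)) 4 *P (Q2 *P E4 *P (Q2 *P E4′)) ∎)
  where
  open ≋-Reasoning
  x = weight q N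
  t = step (powP Q (N ℕ.+ N))
  O4 = powP (oddFact N) 4
  E4 = powP (evenFact N) 4
  E4′ = powP (evenFact (suc N)) 4
  Q2 = Q *P Q
  b = ω (suc N ℕ.+ suc N)
  o = ω (suc (N ℕ.+ N))

rhs-Rep : ∀ n → Rep (rhs n) (target q *P powP (geo Q n) 4) (Q *P Q)
rhs-Rep n = Rep-conv (Rep-*F
    (Rep--F (Rep-+F (Rep-*F (const-Rep (+ 2)) (qpow-Rep 1)) (Rep-*F (const-Rep (+ 2)) (qpow⁻-Rep 0))) oneF-Rep)
    (Rep-powF qint-n 4))
  (*P-≉[] (X^≉[] 2) (X^≉[] 2)) (begin
    c *P g *P (Q *P Q)           ≈⟨ solve 3 (λ c g d → c :* g :* d := c :* d :* g) ≋-refl c g (Q *P Q) ⟩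
    -- The fraction of `c` by `d` is 2q + 2q⁻¹ - 1, so this is the identity behind `target`, on
    -- closed coefficient lists and checked by evaluation.
    c *P (Q *P Q) *P g           ≈⟨ *P-congʳ {c *P (Q *P Q)} {target q *P (d *P powP oneP 4)} (≈P⇒≋ refl) g ⟩
    target q *P (d *P powP oneP 4) *P g
      ≈⟨ solve 3 (λ t g d → t :* d :* g := t :* g :* d) ≋-refl (target q) g (d *P powP oneP 4) ⟩
    target q *P g *P (d *P powP oneP 4) ∎)
  where
  open ≋-Reasoning
  g = powP (geo Q n) 4
  c = ([ + 2 ] *P q *P (oneP *P q) +P [ + 2 ] *P oneP *P (oneP *P oneP)) *P oneP -P oneP *P (oneP *P oneP *P (oneP *P q))
  d = oneP *P oneP *P (oneP *P q) *P oneP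
  const-Rep : ∀ m → Rep (constF m) [ m ] oneP
  const-Rep m = Rep-refl (const≉[] λ ())
  qint-n : Rep (qint 2 (+ n)) (geo Q n) oneP
  qint-n = Rep-conv (qint-Rep 1 {+ n} (subst (λ i → Rep (qpow i) (X^ (2 ℕ.* n)) oneP) (ℤₚ.pos-* 2 n) (qpow-Rep (2 ℕ.* n))))
    (const≉[] λ ()) (begin
      (oneP -P X^ (2 ℕ.* n)) *P oneP   ≈⟨ Poly.*-identityʳ (oneP -P X^ (2 ℕ.* n)) ⟩
      oneP -P X^ (2 ℕ.* n)
        ≈⟨ +P-cong (≋-refl {oneP}) (negP-cong (≋-trans (Poly.reflexive (cong X^ (ℕₚ.*-comm 2 n))) (X^-* n 2))) ⟩
      ω n                              ≈⟨ ω≋geo n ⟩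
      geo Q n *P ω 1                   ≈⟨ solve 2 (λ g Q → g :* (con 1ℤ :- con 1ℤ :* Q) := g :* (con 1ℤ :* (con 1ℤ :- Q))) ≋-refl (geo Q n) Q ⟩
      geo Q n *P (oneP *P (oneP -P Q)) ∎)

-- The congruences

Coprime-powP : ∀ {a p} → Coprime a p → ∀ k → Coprime (powP a k) p
Coprime-powP {p = p} c zero    = Coprime-const p λ ()
Coprime-powP         c (suc k) = Coprime-*P (Coprime-powP c k) c

Coprime-∣ʳ : ∀ {a p r} s → r ≋ s *P p → Coprime a r → Coprime a p
Coprime-∣ʳ s e c = Coprime-sym (Coprime-factor s (Coprime-cong e (Coprime-sym c)))

x+1∣x^odd+1 : ∀ x h → ∃ λ s → s *P (oneP +P x) ≋ powP x (suc (h ℕ.+ h)) +P oneP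
x+1∣x^odd+1 x zero    = oneP , solve 1 (λ x → con 1ℤ :* (con 1ℤ :+ x) := con 1ℤ :* x :+ con 1ℤ) ≋-refl x
x+1∣x^odd+1 x (suc h) = x *P x *P s +P (oneP -P x) , (begin
  (x *P x *P s +P (oneP -P x)) *P (oneP +P x)
    ≈⟨ solve 2 (λ x s → (x :* x :* s :+ (con 1ℤ :- x)) :* (con 1ℤ :+ x)
         := x :* x :* (s :* (con 1ℤ :+ x)) :+ (con 1ℤ :- x :* x)) ≋-refl x s ⟩
  x *P x *P (s *P (oneP +P x)) +P (oneP -P x *P x)
    ≈⟨ +P-cong (*P-congˡ (x *P x) (proj₂ ih)) (≋-refl {oneP -P x *P x}) ⟩
  x *P x *P (powP x (suc (h ℕ.+ h)) +P oneP) +P (oneP -P x *P x)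
    ≈⟨ solve 2 (λ x y → x :* x :* (y :* x :+ con 1ℤ) :+ (con 1ℤ :- x :* x) := y :* x :* x :* x :+ con 1ℤ) ≋-refl x (powP x (h ℕ.+ h)) ⟩
  powP x (suc (suc (suc (h ℕ.+ h)))) +P oneP
    ≡⟨ cong (λ k → powP x (suc (suc k)) +P oneP) (sym (ℕₚ.+-suc h h)) ⟩
  powP x (suc (suc h ℕ.+ suc h)) +P oneP ∎)
  where
  open ≋-Reasoning
  ih = x+1∣x^odd+1 x h
  s = proj₁ ih

-- Since n is odd, 1 + Qᵏ divides 1 + Q^{kn} ≡ 2 modulo Qⁿ − 1.
1+Q^k-Coprime : ∀ h k → Coprime (oneP +P powP Q k) (powP Q (suc (h ℕ.+ h)) -P oneP)
1+Q^k-Coprime h k = bezout s (negP g) (+ 2) (λ ()) (begin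
  s *P (oneP +P x) +P negP g *P (powP Q n -P oneP)
    ≈⟨ +P-cong (proj₂ xs) (solve 2 (λ g y → (:- g) :* y := :- (g :* y)) ≋-refl g (powP Q n -P oneP)) ⟩
  (powP x n +P oneP) -P g *P (powP Q n -P oneP)
    ≈⟨ +P-cong (+P-cong (≋-trans (≋-sym (powP-* Q n k)) (≋-trans (Poly.reflexive (cong (powP Q) (ℕₚ.*-comm n k))) (powP-* Q k n)))
         (≋-refl {oneP})) (negP-cong (geo-sum (powP Q n) k)) ⟩
  (powP (powP Q n) k +P oneP) -P (powP (powP Q n) k -P oneP)
    ≈⟨ solve 1 (λ y → (y :+ con 1ℤ) :- (y :- con 1ℤ) := con (+ 2)) ≋-refl (powP (powP Q n) k) ⟩
  [ + 2 ] ∎)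
  where
  open ≋-Reasoning
  n = suc (h ℕ.+ h)
  x = powP Q k
  xs = x+1∣x^odd+1 x h
  s = proj₁ xs
  g = geo (powP Q n) k

plusFact-Coprime : ∀ h N → Coprime (plusFact N) (powP Q (suc (h ℕ.+ h)) -P oneP)
plusFact-Coprime h zero    = Coprime-const _ λ ()
plusFact-Coprime h (suc N) = Coprime-*P (plusFact-Coprime h N) (1+Q^k-Coprime h (suc N))

Q-Coprime : ∀ n → Coprime Q (powP Q (suc n) -P oneP)
Q-Coprime n = bezout (powP Q n) (negP oneP) 1ℤ (λ ())
  (solve 2 (λ x Q → x :* Q :+ (:- con 1ℤ) :* (x :* Q :- con 1ℤ) := con 1ℤ) ≋-refl (powP Q n) Q)

qintPoly≋geo : ∀ n → qintPoly 2 n ≋ geo Q n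
qintPoly≋geo zero    = ≋-refl
qintPoly≋geo (suc n) = +P-cong (qintPoly≋geo n) (≋-trans (Poly.reflexive (cong X^ (ℕₚ.*-comm 2 n))) (X^-* n 2))

unity-∘P : ∀ n → unity n ∘P Q ≋ powP Q n -P oneP
unity-∘P n = ≋-trans (∘P-+P (X^ n) (negP oneP) Q) (+P-cong (∘P-X^ n Q) (∘P-const (ℤ.- 1ℤ) Q))

-- Assembly for n = 2h + 1

module _ (h′ : ℕ) where
  private
    h n : ℕ
    h = suc h′
    n = suc (h ℕ.+ h)
    Φ P₀ : Poly
    Φ = cyclotomic n ∘P Q
    P₀ = powP Q n -P oneP

  Φ∣P₀ : P₀ ≋ prodΦ n (h ℕ.+ h) ∘P Q *P Φ
  Φ∣P₀ = begin
    P₀                             ≈⟨ ≋-sym (unity-∘P n) ⟩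
    unity n ∘P Q                   ≈⟨ ∘P-cong (≋-sym (cyclotomic-product (cyclotomic-isCyclotomic (h ℕ.+ h)))) Q ⟩
    (cyclotomic n *P prodΦ n (h ℕ.+ h)) ∘P Q ≈⟨ ∘P-*P (cyclotomic n) (prodΦ n (h ℕ.+ h)) Q ⟩
    Φ *P prodΦ n (h ℕ.+ h) ∘P Q    ≈⟨ *P-comm Φ (prodΦ n (h ℕ.+ h) ∘P Q) ⟩
    prodΦ n (h ℕ.+ h) ∘P Q *P Φ    ∎
    where open ≋-Reasoning

  ω-Coprime : ∀ j → suc j < n → Coprime (ω (suc j)) Φ
  ω-Coprime j j<n = Coprime-cong (begin
      [ ℤ.- 1ℤ ] *P unity (suc j) ∘P Q            ≈⟨ *P-congˡ [ ℤ.- 1ℤ ] (unity-∘P (suc j)) ⟩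
      [ ℤ.- 1ℤ ] *P (powP Q (suc j) -P oneP)
        ≈⟨ solve 1 (λ x → con (ℤ.- 1ℤ) :* (x :- con 1ℤ) := con 1ℤ :- x) ≋-refl (powP Q (suc j)) ⟩
      ω (suc j)                                   ∎)
    (Coprime-*P {[ ℤ.- 1ℤ ]} {unity (suc j) ∘P Q} (Coprime-const Φ λ ())
      (Coprime-∘P (unity-Coprime (λ {k} _ → cyclotomic-isCyclotomic k) (ℕ∣.>⇒∤ j<n)) Q))
    where open ≋-Reasoning

  -- [n]_Q and Φₙ(Q) both divide Qⁿ - 1, and coprimality passes to divisors and products; so one
  -- coprimality statement settles the modulus with all its multiplicities.
  Coprime-modulus : ∀ {d} → Coprime d P₀ → Coprime d (modulus n)
  Coprime-modulus c = Coprime-sym (Coprime-*P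
    (Coprime-powP (Coprime-sym (Coprime-∣ʳ (Q -P oneP) (begin
      P₀                              ≈⟨ ≋-sym (geo-sum Q n) ⟩
      geo Q n *P (Q -P oneP)          ≈⟨ *P-comm (geo Q n) (Q -P oneP) ⟩
      (Q -P oneP) *P geo Q n          ≈⟨ *P-congˡ (Q -P oneP) (≋-sym (qintPoly≋geo n)) ⟩
      (Q -P oneP) *P qintPoly 2 n     ∎) c)) 4)
    (Coprime-sym (Coprime-∣ʳ (prodΦ n (h ℕ.+ h) ∘P Q) Φ∣P₀ c)))
    where open ≋-Reasoning

  -- The difference of the two sides is exactly [n]_Q⁴ `Z` / (Q² `W4`), so that only `Z` needs to be
  -- divisible by Φₙ(Q). That divisibility holds over ℚ; its integer `m` joins the denominator,
  -- where it does not affect coprimality.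
  sum-congruence : ∀ N c → oddFact N *P (plusFact N *P plusFact N) ≋ geo Q n *P c *P evenFact N →
    Mod Φ (powP c 4 *P weight q N) (target q *P powP (plusFact N *P plusFact N) 4) →
    sumF term (suc N) ≡F rhs n [mod modulus n ]
  sum-congruence N c odd-split (congruent (dividesˢ m m≢0 t eq)) =
      (λ e → Rep.den≉[] sum-W (≈P⇒≋ e)) , (λ e → Rep.den≉[] (rhs-Rep n) (≈P⇒≋ e))
    , t , [ m ] *P (Q2 *P W4) , Coprime⇒CoprimeP (Coprime-modulus D-Coprime) , ≋⇒≈P congruence
    where
    open ≋-Reasoning
    W = plusFact N *P plusFact N
    W4 = powP W 4
    Q2 = Q *P Q
    G4 = powP (geo Q n) 4
    C4 = powP c 4
    O4 = powP (oddFact N) 4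
    E4 = powP (evenFact N) 4
    w = weight q N
    Z = C4 *P w -P target q *P W4
    D-Coprime : Coprime ([ m ] *P (Q2 *P W4)) P₀
    D-Coprime = Coprime-*P (Coprime-const P₀ m≢0) (Coprime-*P
      (Coprime-*P (Q-Coprime (h ℕ.+ h)) (Q-Coprime (h ℕ.+ h)))
      (Coprime-powP (Coprime-*P (plusFact-Coprime h N) (plusFact-Coprime h N)) 4))
    Q2≉[] : ¬ (Q2 ≋ [])
    Q2≉[] = *P-≉[] (X^≉[] 2) (X^≉[] 2)
    plusFact≉[] : ∀ N → ¬ (plusFact N ≋ [])
    plusFact≉[] N e = evenFact≉[] N (≋-trans (evenFact-split N) (≋-trans (*P-congˡ (fact N) e) (*P-zeroʳ (fact N))))
    Q2W4≉[] : ¬ (Q2 *P W4 ≋ [])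
    Q2W4≉[] = *P-≉[] Q2≉[] (powP-≉[] (*P-≉[] (plusFact≉[] N) (plusFact≉[] N)) 4)
    fourths : O4 *P W4 ≋ G4 *P C4 *P E4
    fourths = begin
      O4 *P W4                                    ≈⟨ ≋-sym (powP-distrib-*P (oddFact N) W 4) ⟩
      powP (oddFact N *P W) 4                     ≈⟨ powP-cong odd-split 4 ⟩
      powP (geo Q n *P c *P evenFact N) 4         ≈⟨ powP-distrib-*P (geo Q n *P c) (evenFact N) 4 ⟩
      powP (geo Q n *P c) 4 *P E4                 ≈⟨ *P-congʳ (powP-distrib-*P (geo Q n) c 4) E4 ⟩
      G4 *P C4 *P E4                              ∎
    sum-W : Rep (sumF term (suc N)) (w *P (G4 *P C4)) (Q2 *P W4)
    sum-W = Rep-conv (sum-Rep N) Q2W4≉[] (begin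
      w *P O4 *P (Q2 *P W4)           ≈⟨ solve 4 (λ w o q v → w :* o :* (q :* v) := w :* q :* (o :* v)) ≋-refl w O4 Q2 W4 ⟩
      w *P Q2 *P (O4 *P W4)           ≈⟨ *P-congˡ (w *P Q2) fourths ⟩
      w *P Q2 *P (G4 *P C4 *P E4)     ≈⟨ solve 4 (λ w q g e → w :* q :* (g :* e) := w :* g :* (q :* e)) ≋-refl w Q2 (G4 *P C4) E4 ⟩
      w *P (G4 *P C4) *P (Q2 *P E4)   ∎)
    difference : Rep (sumF term (suc N) -F rhs n) (G4 *P Z) (Q2 *P W4)
    difference = Rep-conv (Rep--F sum-W (rhs-Rep n)) Q2W4≉[]
      (solve 6 (λ w G C Q2 W t → (w :* (G :* C) :* Q2 :- t :* G :* (Q2 :* W)) :* (Q2 :* W)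
          := G :* (C :* w :- t :* W) :* (Q2 :* W :* Q2)) ≋-refl w G4 C4 Q2 W4 (target q))
    A-B = sumF term (suc N) -F rhs n
    congruence : num A-B *P ([ m ] *P (Q2 *P W4)) ≋ modulus n *P t *P den A-B
    congruence = begin
      num A-B *P ([ m ] *P (Q2 *P W4))   ≈⟨ solve 3 (λ x m y → x :* (m :* y) := m :* (x :* y)) ≋-refl (num A-B) [ m ] (Q2 *P W4) ⟩
      [ m ] *P (num A-B *P (Q2 *P W4))   ≈⟨ *P-congˡ [ m ] (Rep.crossed difference) ⟩
      [ m ] *P (G4 *P Z *P den A-B)      ≈⟨ solve 4 (λ m g z d → m :* (g :* z :* d) := g :* (m :* z) :* d) ≋-refl [ m ] G4 Z (den A-B) ⟩
      G4 *P ([ m ] *P Z) *P den A-B      ≈⟨ *P-congʳ (*P-cong (≋-sym (powP-cong (qintPoly≋geo n) 4)) eq) (den A-B) ⟩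
      powP (qintPoly 2 n) 4 *P (t *P Φ) *P den A-B
        ≈⟨ solve 4 (λ g t p d → g :* (t :* p) :* d := g :* p :* t :* d) ≋-refl (powP (qintPoly 2 n) 4) t Φ (den A-B) ⟩
      modulus n *P t *P den A-B ∎

  open Residues h′ Φ (congruent (∣ˢ-factor (prodΦ n (h ℕ.+ h) ∘P Q) Φ∣P₀)) ω-Coprime
    using (halfCatalan-weight; catalan-weight)

  -- `sumF` stops before its argument, so the last index is h + 1 = (n+1)/2.
  half-sum : sumF term (suc (suc h)) ≡F rhs n [mod modulus n ]
  half-sum = sum-congruence (suc h) (halfCatalan h) (oddFact-geo (suc h) n (halfCatalan h) (gauss-halfCatalan h))
    (halfCatalan-weight q ≋-refl)

  full-sum : sumF term (suc (h ℕ.+ h)) ≡F rhs n [mod modulus n ]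
  -- `catalan M` belongs to N = M + 1; for N = h + h = n - 1 this is M = h′ + h.
  full-sum = sum-congruence (h ℕ.+ h) (catalan (h′ ℕ.+ h)) (oddFact-geo (h ℕ.+ h) n (catalan (h′ ℕ.+ h)) (gauss-catalan (h′ ℕ.+ h)))
    (catalan-weight q ≋-refl)

odd-decompose : ∀ n → 1 < n → n % 2 ≡ 1 → ∃ λ k → n ≡ suc (suc k ℕ.+ suc k)
odd-decompose n 1<n n%2≡1 = go (n / 2) (trans (m≡m%n+[m/n]*n n 2) (cong (ℕ._+ n / 2 ℕ.* 2) n%2≡1))
  where
  double : ∀ k → 1 ℕ.+ suc k ℕ.* 2 ≡ suc (suc k ℕ.+ suc k)
  double = ℕRing.solve-∀
  go : ∀ k → n ≡ 1 ℕ.+ k ℕ.* 2 → ∃ λ k → n ≡ suc (suc k ℕ.+ suc k)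
  go zero    eq = contradiction eq (ℕₚ.>⇒≢ 1<n)
  go (suc k) eq = k , trans eq (double k)

theorem1p1 : (n : ℕ) → 1 < n → n % 2 ≡ 1 →
    (sumF term (suc ((n + 1) / 2)) ≡F rhs n [mod modulus n ])
    × (sumF term (suc (n ∸ 1)) ≡F rhs n [mod modulus n ])
theorem1p1 n 1<n n%2≡1 with odd-decompose n 1<n n%2≡1
... | k , refl = subst (λ N → sumF term (suc N) ≡F rhs n [mod modulus n ]) (sym half) (half-sum k) , full-sum k
  where
  double : ∀ k → suc (suc k ℕ.+ suc k) ℕ.+ 1 ≡ suc (suc k) ℕ.* 2
  double = ℕRing.solve-∀
  half : (n + 1) / 2 ≡ suc (suc k)
  half = trans (cong (_/ 2) (double k)) (m*n/n≡m (suc (suc k)) 2)
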